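{- Let $S$ be a finite set of positive integers. Then: (1) the generating function $\mathcal M_S(q) := \sum_{n\ge0} M_S(n) q^n$ can be written as $\mathcal M_S(q) = \dfrac{f_S(q)}{\prod_{j\in S}(1-q^j)}$ where $f_S(q)$ is a polynomial with integer coefficients; (2) there exists $n_0$ such that for $n\ge n_0$, $M_S(n)$ is given by a quasipolynomial, i.e. $M_S(n) = \sum_{i=0}^{m} c_i(n)\, n^i$ with each $c_i$ a periodic function of $n$; moreover, the $c_i$ may be taken to be sums of periodic functions whose periods are divisors of elements of $S$.
   Context: $M_S(n)$ is the number of distinct values of the multinomial coefficients $n!/(\lambda_1!\cdots\lambda_r!)$ as $(\lambda_1,\dots,\lambda_r)$ ranges over all partitions of $n$ whose parts all lie in $S$. -}

module Defs where

open import Data.Nat using (ℕ; zero; suc; _+_; _*_; _∸_; _≤_; _≤?_; _!; _/_; NonZero)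
open import Data.Nat.Properties using (_!≢0; m*n≢0)
import Data.Nat as ℕ
open import Data.Integer as ℤ using (ℤ; +_)
open import Data.Rational as ℚ using (ℚ)
open import Data.Fin using (Fin; zero; suc)
open import Data.List using (List; []; _∷_; [_]; _++_; map; concatMap; filter; upTo; replicate; length; deduplicate)
open import Data.Nat.ListAction using (sum)
open import Relation.Nullary using (yes; no)

prodFact : List ℕ → ℕ
prodFact []       = 1
prodFact (x ∷ xs) = x ! * prodFact xs

prodFact≢0 : (xs : List ℕ) → NonZero (prodFact xs)
prodFact≢0 []       = _
prodFact≢0 (x ∷ xs) = m*n≢0 (x !) (prodFact xs) {{x !≢0}} {{prodFact≢0 xs}}

multinomial : List ℕ → ℕ
multinomial λs = ((sum λs) ! / prodFact λs) {{prodFact≢0 λs}}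

-- All partitions of n whose parts lie in S, for S given as a duplicate-free
-- list of positive integers.  A partition is a multiset of parts; it is
-- listed once, as  replicate m₁ s₁ ++ replicate m₂ s₂ ++ ⋯  where
-- S = s₁ ∷ s₂ ∷ ⋯ and mᵢ is the multiplicity of sᵢ.
partitionsIn : List ℕ → ℕ → List (List ℕ)
partitionsIn []      zero    = [ [] ]
partitionsIn []      (suc _) = []
partitionsIn (s ∷ S) n =
  concatMap (λ m → map (replicate m s ++_) (partitionsIn S (n ∸ m * s)))
            (filter (λ m → m * s ≤? n) (upTo (suc n)))

M : List ℕ → ℕ → ℕ
M S n = length (deduplicate ℕ._≟_ (map multinomial (partitionsIn S n)))

-- Formal power series over ℤ are functions ℕ → ℤ (coefficient sequences).

coeff : List ℤ → ℕ → ℤ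
coeff []       _       = + 0
coeff (a ∷ as) zero    = a
coeff (a ∷ as) (suc n) = coeff as n

sumℤ : ℕ → (ℕ → ℤ) → ℤ
sumℤ zero    f = + 0
sumℤ (suc n) f = sumℤ n f ℤ.+ f n

conv : (ℕ → ℤ) → (ℕ → ℤ) → ℕ → ℤ
conv a b n = sumℤ (suc n) (λ i → a i ℤ.* b (n ∸ i))

one : ℕ → ℤ
one zero    = + 1
one (suc _) = + 0

mulOneMinusQ^ : ℕ → (ℕ → ℤ) → ℕ → ℤ
mulOneMinusQ^ j a n with j ≤? n
... | yes _ = a n ℤ.- a (n ∸ j)
... | no _  = a n

prodOneMinusQ : List ℕ → ℕ → ℤ
prodOneMinusQ []      = one
prodOneMinusQ (j ∷ S) = mulOneMinusQ^ j (prodOneMinusQ S)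

sumℚ : (k : ℕ) → (Fin k → ℚ) → ℚ
sumℚ zero    f = ℚ.0ℚ
sumℚ (suc k) f = f zero ℚ.+ sumℚ k (λ i → f (suc i))

ℕtoℚ : ℕ → ℚ
ℕtoℚ n = (+ n) ℚ./ 1

{-# OPTIONS --safe #-}

-- For fixed n, the value n!/∏ s!^(m_s) determines and is determined by the exponents of the primes
-- in ∏ s!^(m_s), so two multiplicity vectors m, m' ∈ ℕ^S are identified precisely when finitely many
-- linear forms agree on them.  The pairs (m, m') on which given linear forms agree form a finitely
-- generated monoid, with computable generators.  Counting each class by its lexicographically least
-- element, M_S(n) becomes the number of vectors of weight n avoiding a finitely generated upward
-- closed set, its generators being the larger components of the generating pairs.  Deleting
-- generators one at a time, f_G = f_{g ∷ G} + q^{|g|} f_{G ∸ g}, reduces the generating function to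
-- that of all vectors, 1/∏(1 − q^s); this gives (1).
--
-- For (2), undo the difference operators a(n) − a(n − s) one by one: if g has period d, then
-- g(n) n^i has an antidifference with step s which is a quasipolynomial with the same period d,
-- because g is the sum of its mean along the orbits of n ↦ n + s and of the s-difference of a
-- d-periodic function.  The constant of summation is s-periodic.
module Submission where

open import Defs
open import Data.List as List using (List; []; _∷_; _++_; [_]; length; filter; concatMap; cartesianProductWith; deduplicate; upTo; applyUpTo; lookup)
open import Data.List.Membership.Propositional using (_∈_; _∉_; find; lose)
open import Data.List.Relation.Unary.All as All using (All; []; _∷_)
open import Data.List.Relation.Unary.Any as Any using (Any; here; there)
open import Data.List.Relation.Unary.Unique.Propositional using (Unique)
open import Data.Vec as Vec using (Vec; []; _∷_; toList; fromList; zipWith; replicate)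
open import Data.Product using (Σ; ∃; _×_; _,_; proj₁; proj₂)
open import Data.Sum using (_⊎_; inj₁; inj₂; [_,_]′)
open import Function using (_∘_; case_of_)
open import Relation.Nullary using (Dec; yes; no; ¬_; ¬?; contradiction)
open import Relation.Unary using (Decidable)
open import Relation.Binary using (tri<; tri≈; tri>)
open import Relation.Binary.PropositionalEquality hiding ([_])

-- Two properties of the lexicographic order make the generators sufficient. It is invariant under
-- translation, so a vector above the larger component of a descending generating pair can itself be
-- lowered within its class. And a sum of pairs that do not descend does not descend, so every
-- vector that can be lowered lies above such a component. Hence the vectors that are not least in
-- their class form a monomial ideal with known generators.
--
-- The generating pairs come from imposing one equation α = β at a time: generators on which α - β
-- is extreme are merged with generators of opposite sign until the two sides agree on all of them.
--
-- In (2) the obstacle is the condition on the periods: a common period of all coefficients would be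
-- a least common multiple, which may divide no element of S. So a quasipolynomial is kept as a list
-- of terms, each with its own period, and antidifferences must preserve that period. The process
-- starts at f_S, which is eventually 0, hence at the empty list; each s then contributes one new
-- term, of period s.

module LinearDiophantine where

  open import Data.Nat
  open import Data.Nat.Properties
  open import Data.List.Membership.Propositional.Properties using (∈-filter⁺; ∈-filter⁻; ∈-++⁺ˡ; ∈-++⁺ʳ; ∈-++⁻; ∈-cartesianProductWith⁺; ∈-cartesianProductWith⁻)
  open import Algebra.Structures using (IsCommutativeMonoid)

  -- Generators for the solutions of linear equations in a commutative monoid

  module FinitelyGenerated {V : Set} {_⊕_ : V → V → V} {𝟎 : V}
                           (isCM : IsCommutativeMonoid _≡_ _⊕_ 𝟎) where

    open IsCommutativeMonoid isCM using (assoc; comm)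

    -- A derivation lists the summands one by one, with repetition, so that regrouping a sum is a
    -- recursion on its derivation.
    data Span (B : List V) : V → Set where
      []  : Span B 𝟎
      _∷_ : ∀ {x v} → x ∈ B → Span B v → Span B (x ⊕ v)

    record Additive (α : V → ℕ) : Set where
      field
        𝟎-homo : α 𝟎 ≡ 0
        ⊕-homo : ∀ x y → α (x ⊕ y) ≡ α x + α y

    open Additive

    ⊕-swap : ∀ x y z → x ⊕ (y ⊕ z) ≡ y ⊕ (x ⊕ z)
    ⊕-swap x y z = trans (sym (assoc x y z)) (trans (cong (_⊕ z) (comm x y)) (assoc y x z))

    -- Two inequalities in ℕ stand for α - β lying in the interval [-a, b].
    Bounded : (V → ℕ) → (V → ℕ) → ℕ → ℕ → V → Set
    Bounded α β a b x = (α x ≤ b + β x) × (β x ≤ a + α x)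

    -- One step of the elimination.  In a sum with α = β, an element where α − β attains its
    -- maximum b + 1 is compensated by elements where α − β is negative; as these are ≥ −(b + 1),
    -- adding one of them brings the difference into [0, b].  Merging greedily leaves either no
    -- unmerged maximal element, or no negative one, and the latter makes α − β positive.
    module LowerTop {α β : V → ℕ} (α-add : Additive α) (β-add : Additive β)
                    {a b : ℕ} (a≤1+b : a ≤ suc b)
                    (B : List V) (bounded : All (Bounded α β a (suc b)) B) where

      Top Negative : V → Set
      Top x = α x ≡ suc b + β x
      Negative x = α x < β x

      top? : Decidable Top
      top? x = α x ≟ suc b + β x

      negative? : Decidable Negative
      negative? x = α x <? β x

      -- The two outcomes of the merging: a sum is over `lowered` when no unmerged maximal element
      -- is left, and over `nonneg` when no unmerged negative one is.
      merged lowered nonneg : List V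
      merged  = cartesianProductWith _⊕_ (filter top? B) (filter negative? B)
      lowered = filter (λ x → ¬? (top? x)) B ++ merged
      nonneg  = filter (λ x → ¬? (negative? x)) B ++ merged

      merge : ∀ {x y} → x ∈ B → Top x → y ∈ B → Negative y → (x ⊕ y) ∈ merged
      merge x∈B tx y∈B ny = ∈-cartesianProductWith⁺ _⊕_ (∈-filter⁺ top? x∈B tx) (∈-filter⁺ negative? y∈B ny)

      merged⇒lowered : ∀ {x} → x ∈ merged → x ∈ lowered
      merged⇒lowered = ∈-++⁺ʳ _

      merged⇒nonneg : ∀ {x} → x ∈ merged → x ∈ nonneg
      merged⇒nonneg = ∈-++⁺ʳ _

      ¬top⇒lowered : ∀ {x} → x ∈ B → ¬ Top x → x ∈ lowered
      ¬top⇒lowered x∈B ¬t = ∈-++⁺ˡ (∈-filter⁺ (λ x → ¬? (top? x)) x∈B ¬t)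

      ¬negative⇒nonneg : ∀ {x} → x ∈ B → ¬ Negative x → x ∈ nonneg
      ¬negative⇒nonneg x∈B ¬n = ∈-++⁺ˡ (∈-filter⁺ (λ x → ¬? (negative? x)) x∈B ¬n)

      lowered-cases : ∀ {x} → x ∈ lowered → (x ∈ B × ¬ Top x) ⊎ x ∈ merged
      lowered-cases x∈ with ∈-++⁻ (filter (λ x → ¬? (top? x)) B) x∈
      ... | inj₁ p = inj₁ (∈-filter⁻ (λ x → ¬? (top? x)) p)
      ... | inj₂ p = inj₂ p

      nonneg-cases : ∀ {x} → x ∈ nonneg → (x ∈ B × ¬ Negative x) ⊎ x ∈ merged
      nonneg-cases x∈ with ∈-++⁻ (filter (λ x → ¬? (negative? x)) B) x∈
      ... | inj₁ p = inj₁ (∈-filter⁻ (λ x → ¬? (negative? x)) p)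
      ... | inj₂ p = inj₂ p

      merged-elim : (P : V → Set) → (∀ {x y} → x ∈ B → Top x → y ∈ B → Negative y → P (x ⊕ y)) →
                    ∀ {x} → x ∈ merged → P x
      merged-elim P f x∈ with ∈-cartesianProductWith⁻ _⊕_ (filter top? B) (filter negative? B) x∈
      ... | x , y , x∈' , y∈' , refl with ∈-filter⁻ top? x∈' | ∈-filter⁻ negative? y∈'
      ... | x∈B , tx | y∈B , ny = f x∈B tx y∈B ny

      merged-≥ : ∀ {x} → x ∈ merged → β x ≤ α x
      merged-≥ = merged-elim (λ x → β x ≤ α x) λ {x} {y} x∈B tx y∈B ny → begin
        β (x ⊕ y)             ≡⟨ ⊕-homo β-add x y ⟩
        β x + β y             ≤⟨ +-monoʳ-≤ (β x) (proj₂ (All.lookup bounded y∈B)) ⟩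
        β x + (a + α y)       ≤⟨ +-monoʳ-≤ (β x) (+-monoˡ-≤ (α y) a≤1+b) ⟩
        β x + (suc b + α y)   ≡⟨ +-assoc (β x) (suc b) (α y) ⟨
        β x + suc b + α y     ≡⟨ cong (_+ α y) (+-comm (β x) (suc b)) ⟩
        suc b + β x + α y     ≡⟨ cong (_+ α y) tx ⟨
        α x + α y             ≡⟨ ⊕-homo α-add x y ⟨
        α (x ⊕ y)             ∎
        where open ≤-Reasoning

      merged-≤ : ∀ {x} → x ∈ merged → α x ≤ b + β x
      merged-≤ = merged-elim (λ x → α x ≤ b + β x) λ {x} {y} x∈B tx y∈B ny → begin
        α (x ⊕ y)              ≡⟨ ⊕-homo α-add x y ⟩
        α x + α y              ≡⟨ cong (_+ α y) tx ⟩
        suc (b + β x + α y)    ≡⟨ +-suc (b + β x) (α y) ⟨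
        b + β x + suc (α y)    ≤⟨ +-monoʳ-≤ (b + β x) ny ⟩
        b + β x + β y          ≡⟨ +-assoc b (β x) (β y) ⟩
        b + (β x + β y)        ≡⟨ cong (b +_) (⊕-homo β-add x y) ⟨
        b + β (x ⊕ y)          ∎
        where open ≤-Reasoning

      lowered-bounded : All (Bounded α β a b) lowered
      lowered-bounded = All.tabulate λ x∈ → go (lowered-cases x∈)
        where
        go : ∀ {x} → (x ∈ B × ¬ Top x) ⊎ x ∈ merged → Bounded α β a b x
        go (inj₁ (x∈B , ¬t)) with All.lookup bounded x∈B
        ... | upper , lower = ≤-pred (≤∧≢⇒< upper ¬t) , lower
        go {x} (inj₂ x∈) = merged-≤ x∈ , ≤-trans (merged-≥ x∈) (m≤n+m (α x) a)

      lowered-invariant : (P : V → Set) → (∀ {x y} → P x → P y → P (x ⊕ y)) → All P B → All P lowered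
      lowered-invariant P P-⊕ PB = All.tabulate λ x∈ → go (lowered-cases x∈)
        where
        go : ∀ {x} → (x ∈ B × ¬ Top x) ⊎ x ∈ merged → P x
        go (inj₁ (x∈B , _)) = All.lookup PB x∈B
        go (inj₂ x∈) = merged-elim P (λ x∈B _ y∈B _ → P-⊕ (All.lookup PB x∈B) (All.lookup PB y∈B)) x∈

      -- Walk along the summands of `v` to the first unmerged negative one and merge `x` with it. If
      -- there is none, `v` is a sum over `nonneg`; this outcome leaves `x` out so that `v` can be
      -- rebuilt summand by summand on the way back.
      absorb-top : ∀ {x v} → x ∈ B → Top x → Span lowered v → Span lowered (x ⊕ v) ⊎ Span nonneg v
      absorb-top x∈B tx [] = inj₂ []
      absorb-top {x} x∈B tx (_∷_ {y} {v} y∈ sp) with lowered-cases y∈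
      ... | inj₁ (y∈B , _) with negative? y
      ...   | yes ny = inj₁ (subst (Span lowered) (assoc x y v) (merged⇒lowered (merge x∈B tx y∈B ny) ∷ sp))
      ...   | no ¬ny with absorb-top x∈B tx sp
      ...     | inj₁ sp' = inj₁ (subst (Span lowered) (⊕-swap y x v) (y∈ ∷ sp'))
      ...     | inj₂ sp' = inj₂ (¬negative⇒nonneg y∈B ¬ny ∷ sp')
      absorb-top {x} x∈B tx (_∷_ {y} {v} y∈ sp) | inj₂ y∈m with absorb-top x∈B tx sp
      ... | inj₁ sp' = inj₁ (subst (Span lowered) (⊕-swap y x v) (y∈ ∷ sp'))
      ... | inj₂ sp' = inj₂ (merged⇒nonneg y∈m ∷ sp')

      absorb-negative : ∀ {x v} → x ∈ B → Negative x → Span nonneg v → Span nonneg (x ⊕ v) ⊎ Span lowered v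
      absorb-negative x∈B nx [] = inj₂ []
      absorb-negative {x} x∈B nx (_∷_ {y} {v} y∈ sp) with nonneg-cases y∈
      ... | inj₁ (y∈B , _) with top? y
      ...   | yes ty = inj₁ (subst (Span nonneg) (trans (assoc y x v) (⊕-swap y x v))
                                   (merged⇒nonneg (merge y∈B ty x∈B nx) ∷ sp))
      ...   | no ¬ty with absorb-negative x∈B nx sp
      ...     | inj₁ sp' = inj₁ (subst (Span nonneg) (⊕-swap y x v) (y∈ ∷ sp'))
      ...     | inj₂ sp' = inj₂ (¬top⇒lowered y∈B ¬ty ∷ sp')
      absorb-negative {x} x∈B nx (_∷_ {y} {v} y∈ sp) | inj₂ y∈m with absorb-negative x∈B nx sp
      ... | inj₁ sp' = inj₁ (subst (Span nonneg) (⊕-swap y x v) (y∈ ∷ sp'))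
      ... | inj₂ sp' = inj₂ (merged⇒lowered y∈m ∷ sp')

      top⇒¬negative : ∀ {x} → Top x → ¬ Negative x
      top⇒¬negative {x} tx nx = <⇒≱ nx (subst (β x ≤_) (sym tx) (m≤n+m (β x) (suc b)))

      negative⇒¬top : ∀ {x} → Negative x → ¬ Top x
      negative⇒¬top nx tx = top⇒¬negative tx nx

      -- Summands are added one at a time. A maximal one can spoil only the first alternative and a
      -- negative one only the second, and absorbing it restores one of the two.
      span-cases : ∀ {v} → Span B v → Span lowered v ⊎ Span nonneg v
      span-cases [] = inj₁ []
      span-cases (_∷_ {x} x∈B sp) with span-cases sp
      ... | inj₁ sp' with top? x
      ...   | no ¬tx = inj₁ (¬top⇒lowered x∈B ¬tx ∷ sp')
      ...   | yes tx with absorb-top x∈B tx sp'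
      ...     | inj₁ sp'' = inj₁ sp''
      ...     | inj₂ sp'' = inj₂ (¬negative⇒nonneg x∈B (top⇒¬negative tx) ∷ sp'')
      span-cases (_∷_ {x} x∈B sp) | inj₂ sp' with negative? x
      ... | no ¬nx = inj₂ (¬negative⇒nonneg x∈B ¬nx ∷ sp')
      ... | yes nx with absorb-negative x∈B nx sp'
      ...   | inj₁ sp'' = inj₂ sp''
      ...   | inj₂ sp'' = inj₁ (¬top⇒lowered x∈B (negative⇒¬top nx) ∷ sp'')

      nonneg-≥ : ∀ {x} → x ∈ nonneg → β x ≤ α x
      nonneg-≥ x∈ with nonneg-cases x∈
      ... | inj₁ (_ , ¬n) = ≮⇒≥ ¬n
      ... | inj₂ x∈m = merged-≥ x∈m

      nonneg-lowered-or-> : ∀ {x} → x ∈ nonneg → x ∈ lowered ⊎ β x < α x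
      nonneg-lowered-or-> {x} x∈ with nonneg-cases x∈
      ... | inj₂ x∈m = inj₁ (merged⇒lowered x∈m)
      ... | inj₁ (x∈B , _) with top? x
      ...   | no ¬tx = inj₁ (¬top⇒lowered x∈B ¬tx)
      ...   | yes tx = inj₂ (subst (β x <_) (sym tx) (s≤s (m≤n+m (β x) b)))

      -- A summand outside `lowered` is a maximal one, with α > β. No other summand compensates for
      -- it, so the inequality for the whole sum is strict, which is impossible when α and β agree
      -- on the sum.
      span-nonneg : ∀ {v} → Span nonneg v → (β v ≤ α v) × (Span lowered v ⊎ β v < α v)
      span-nonneg [] = ≤-reflexive (trans (𝟎-homo β-add) (sym (𝟎-homo α-add))) , inj₁ []
      span-nonneg (_∷_ {x} {v} x∈ sp) with span-nonneg sp
      ... | v≥ , vcase = ≤-homo (+-mono-≤ (nonneg-≥ x∈) v≥) , go (nonneg-lowered-or-> x∈) vcase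
        where
        ≤-homo : β x + β v ≤ α x + α v → β (x ⊕ v) ≤ α (x ⊕ v)
        ≤-homo = subst₂ _≤_ (sym (⊕-homo β-add x v)) (sym (⊕-homo α-add x v))
        <-homo : β x + β v < α x + α v → β (x ⊕ v) < α (x ⊕ v)
        <-homo = subst₂ _<_ (sym (⊕-homo β-add x v)) (sym (⊕-homo α-add x v))
        go : x ∈ lowered ⊎ β x < α x → Span lowered v ⊎ β v < α v →
             Span lowered (x ⊕ v) ⊎ β (x ⊕ v) < α (x ⊕ v)
        go (inj₁ x∈l) (inj₁ sp') = inj₁ (x∈l ∷ sp')
        go (inj₁ _) (inj₂ v>) = inj₂ (<-homo (+-mono-≤-< (nonneg-≥ x∈) v>))
        go (inj₂ x>) _ = inj₂ (<-homo (+-mono-<-≤ x> v≥))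

      lowered-spans : ∀ {v} → Span B v → α v ≡ β v → Span lowered v
      lowered-spans sp eq with span-cases sp
      ... | inj₁ sp' = sp'
      ... | inj₂ sp' with proj₂ (span-nonneg sp')
      ...   | inj₁ sp'' = sp''
      ...   | inj₂ v> = contradiction (sym eq) (<⇒≢ v>)

    -- `P` carries the equations imposed earlier: they must survive the merging done for the new
    -- one.
    record Restricts (P : V → Set) (α β : V → ℕ) (B B' : List V) : Set where
      field
        balanced  : All (λ x → α x ≡ β x) B'
        invariant : All P B'
        spans     : ∀ {v} → Span B v → α v ≡ β v → Span B' v

    upper-bound : ∀ (α β : V → ℕ) (B : List V) → Σ ℕ λ c → All (λ x → α x ≤ c + β x) B
    upper-bound α β [] = 0 , []
    upper-bound α β (x ∷ B) with upper-bound α β B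
    ... | c , bd = α x + c
      , ≤-trans (m≤m+n (α x) c) (m≤m+n (α x + c) (β x))
      ∷ All.map (λ {y} p → ≤-trans p (+-monoˡ-≤ (β y) (m≤n+m c (α x)))) bd

    module _ (P : V → Set) (P-⊕ : ∀ {x y} → P x → P y → P (x ⊕ y)) where

      -- Each round shortens the longer side of [-a, b] by one; choosing the longer side supplies
      -- the hypothesis `a≤1+b` of `LowerTop`. At width 0 the bounds say that α = β on every
      -- generator.
      restrict-bounded : ∀ fuel {α β} → Additive α → Additive β → ∀ a b → a + b ≤ fuel →
                         ∀ B → All P B → All (Bounded α β a b) B → Σ (List V) (Restricts P α β B)
      restrict-bounded _ α-add β-add zero zero _ B PB bd = B , record
        { balanced  = All.map (λ (p , q) → ≤-antisym p q) bd
        ; invariant = PB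
        ; spans     = λ sp _ → sp }
      restrict-bounded zero α-add β-add zero (suc b) () B PB bd
      restrict-bounded zero α-add β-add (suc a) b () B PB bd
      restrict-bounded (suc fuel) α-add β-add a b a+b≤ B PB bd with a ≤? b
      restrict-bounded (suc fuel) α-add β-add zero zero a+b≤ B PB bd | yes a≤b =
        restrict-bounded fuel α-add β-add zero zero z≤n B PB bd
      restrict-bounded (suc fuel) α-add β-add a (suc b) a+b≤ B PB bd | yes a≤b =
        let open LowerTop α-add β-add a≤b B bd
            B' , r = restrict-bounded fuel α-add β-add a b (≤-pred (subst (_≤ suc fuel) (+-suc a b) a+b≤))
                       lowered (lowered-invariant P P-⊕ PB) lowered-bounded
            open Restricts r
        in B' , record { balanced = balanced ; invariant = invariant
                       ; spans = λ sp eq → spans (lowered-spans sp eq) eq }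
      restrict-bounded (suc fuel) α-add β-add zero b a+b≤ B PB bd | no a≰b = contradiction z≤n a≰b
      restrict-bounded (suc fuel) α-add β-add (suc a) b a+b≤ B PB bd | no a≰b =
        -- The negative side is the longer one, so α and β exchange roles.
        let open LowerTop β-add α-add (<⇒≤ (≰⇒> a≰b)) B (All.map (λ (p , q) → q , p) bd)
            B' , r = restrict-bounded fuel α-add β-add a b (≤-pred a+b≤) lowered
                       (lowered-invariant P P-⊕ PB) (All.map (λ (p , q) → q , p) lowered-bounded)
            open Restricts r
        in B' , record { balanced = balanced ; invariant = invariant
                       ; spans = λ sp eq → spans (lowered-spans sp (sym eq)) eq }

      restrict : ∀ {α β} → Additive α → Additive β → ∀ B → All P B → Σ (List V) (Restricts P α β B)
      restrict {α} {β} α-add β-add B PB =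
        let b , upper = upper-bound α β B
            a , lower = upper-bound β α B
        in restrict-bounded (a + b) α-add β-add a b ≤-refl B PB (All.zip (upper , lower))

    Equation : Set
    Equation = Σ (V → ℕ) λ α → Σ (V → ℕ) λ β → Additive α × Additive β

    Solves : V → Equation → Set
    Solves v (α , β , _) = α v ≡ β v

    solves-⊕ : ∀ {E x y} → Solves x E → Solves y E → Solves (x ⊕ y) E
    solves-⊕ {α , β , α-add , β-add} {x} {y} p q =
      trans (⊕-homo α-add x y) (trans (cong₂ _+_ p q) (sym (⊕-homo β-add x y)))

    solution-basis : ∀ (Es : List Equation) B₀ → (∀ v → Span B₀ v) →
      Σ (List V) λ B → All (λ x → All (Solves x) Es) B × (∀ {v} → All (Solves v) Es → Span B v)
    solution-basis [] B₀ all = B₀ , All.tabulate (λ _ → []) , λ {v} _ → all v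
    solution-basis (E@(α , β , α-add , β-add) ∷ Es) B₀ all =
      let B , sound , complete = solution-basis Es B₀ all
          B' , r = restrict (λ x → All (Solves x) Es)
                     (λ {x} {y} p q → All.map (λ {E} (p' , q') → solves-⊕ {E} {x} {y} p' q') (All.zip (p , q)))
                     α-add β-add B sound
          open Restricts r
      in B' , All.zipWith (λ (p , q) → p ∷ q) (balanced , invariant)
            , λ { (p ∷ q) → spans (complete q) p }

-- Comparing lengths of lists, and vectors of naturals with their orders

module Counting where

  open import Data.Nat
  open import Data.Nat.Properties
  open import Data.Nat.Solver using (module +-*-Solver)
  open import Data.List.Properties using (length-++; length-map)
  open import Data.List.Membership.Propositional.Properties
  import Data.List.Relation.Unary.All.Properties as All
  open import Data.List.Relation.Unary.AllPairs using ([]; _∷_)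
  import Data.List.Relation.Unary.Unique.Propositional.Properties as Unique
  open import Data.Vec.Properties using (∷-injective)
  open import Data.Vec.Relation.Unary.All as VAll using ([]; _∷_)
  open import Data.Vec.Relation.Binary.Pointwise.Inductive as Pointwise using (Pointwise; []; _∷_)
  open import Data.Vec.Relation.Binary.Lex.Strict as Lex using (Lex-<; base; this; next)

  -- The injection is a relation because the partner that `total` provides may depend on the
  -- membership proof. Each partner found is removed from `ys` before the recursion.
  length-≤-injection : ∀ {A B : Set} (R : A → B → Set) {xs : List A} {ys : List B} → Unique xs →
    (∀ {x} → x ∈ xs → ∃ λ y → y ∈ ys × R x y) →
    (∀ {x x' y} → x ∈ xs → x' ∈ xs → R x y → R x' y → x ≡ x') →
    length xs ≤ length ys
  length-≤-injection R {[]} uniq total inj = z≤n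
  length-≤-injection R {x ∷ xs} (x∉xs ∷ uniq) total inj with total (here refl)
  ... | y , y∈ys , Rxy with ∈-∃++ y∈ys
  ... | as , bs , refl = ≤-trans (s≤s (length-≤-injection R uniq total' (λ p q → inj (there p) (there q))))
                                 (≤-reflexive lengths)
    where
    lengths : suc (length (as ++ bs)) ≡ length (as ++ y ∷ bs)
    lengths = trans (cong suc (length-++ as)) (trans (sym (+-suc _ _)) (sym (length-++ as)))
    total' : ∀ {x'} → x' ∈ xs → ∃ λ y' → y' ∈ as ++ bs × R x' y'
    total' x'∈xs with total (there x'∈xs)
    ... | y' , y'∈ys , Rx'y' with ∈-++⁻ as y'∈ys
    ...   | inj₁ y'∈as = y' , ∈-++⁺ˡ y'∈as , Rx'y'
    ...   | inj₂ (there y'∈bs) = y' , ∈-++⁺ʳ as y'∈bs , Rx'y'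
    -- A later element paired with the removed `y` would equal `x`, against uniqueness.
    ...   | inj₂ (here refl) = contradiction (inj (here refl) (there x'∈xs) Rxy Rx'y') (All.lookup x∉xs x'∈xs)

  length-≡-sameMembers : ∀ {A : Set} {xs ys : List A} → Unique xs → Unique ys →
    (∀ {x} → x ∈ xs → x ∈ ys) → (∀ {x} → x ∈ ys → x ∈ xs) → length xs ≡ length ys
  length-≡-sameMembers xs! ys! to from = ≤-antisym
    (length-≤-injection _≡_ xs! (λ p → _ , to p , refl) (λ _ _ p q → trans p (sym q)))
    (length-≤-injection _≡_ ys! (λ p → _ , from p , refl) (λ _ _ p q → trans p (sym q)))

  infixl 6 _+ᵛ_ _∸ᵛ_
  infix 4 _≤ᵛ_ _≤ᵛ?_ _<ˡ_ _<ˡ?_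

  _+ᵛ_ _∸ᵛ_ : ∀ {k} → Vec ℕ k → Vec ℕ k → Vec ℕ k
  _+ᵛ_ = zipWith _+_
  _∸ᵛ_ = zipWith _∸_

  0ᵛ : ∀ {k} → Vec ℕ k
  0ᵛ = replicate _ 0

  _≤ᵛ_ : ∀ {k} → Vec ℕ k → Vec ℕ k → Set
  _≤ᵛ_ = Pointwise _≤_

  _≤ᵛ?_ : ∀ {k} (g m : Vec ℕ k) → Dec (g ≤ᵛ m)
  _≤ᵛ?_ = Pointwise.decidable _≤?_

  _<ˡ_ : ∀ {k} → Vec ℕ k → Vec ℕ k → Set
  _<ˡ_ = Lex-< _≡_ _<_

  _<ˡ?_ : ∀ {k} (m n : Vec ℕ k) → Dec (m <ˡ n)
  _<ˡ?_ = Lex.<-decidable _≟_ _<?_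

  dot : ∀ {k} → Vec ℕ k → Vec ℕ k → ℕ
  dot []       []       = 0
  dot (c ∷ cs) (m ∷ ms) = m * c + dot cs ms

  dot-+ : ∀ {k} (c m n : Vec ℕ k) → dot c (m +ᵛ n) ≡ dot c m + dot c n
  dot-+ [] [] [] = refl
  dot-+ (c ∷ cs) (m ∷ ms) (n ∷ ns) rewrite dot-+ cs ms ns =
    solve 5 (λ c m n x y → (m :+ n) :* c :+ (x :+ y) := (m :* c :+ x) :+ (n :* c :+ y)) refl
          c m n (dot cs ms) (dot cs ns)
    where open +-*-Solver

  dot-0 : ∀ {k} (c : Vec ℕ k) → dot c 0ᵛ ≡ 0
  dot-0 [] = refl
  dot-0 (c ∷ cs) = dot-0 cs

  +ᵛ-∸ᵛ : ∀ {k} {g m : Vec ℕ k} → g ≤ᵛ m → g +ᵛ (m ∸ᵛ g) ≡ m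
  +ᵛ-∸ᵛ [] = refl
  +ᵛ-∸ᵛ (p ∷ ps) = cong₂ _∷_ (m+[n∸m]≡n p) (+ᵛ-∸ᵛ ps)

  +ᵛ-cancelˡ : ∀ {k} (g : Vec ℕ k) {m n} → g +ᵛ m ≡ g +ᵛ n → m ≡ n
  +ᵛ-cancelˡ [] {[]} {[]} _ = refl
  +ᵛ-cancelˡ (x ∷ g) {_ ∷ _} {_ ∷ _} eq with ∷-injective eq
  ... | p , q = cong₂ _∷_ (+-cancelˡ-≡ x _ _ p) (+ᵛ-cancelˡ g q)

  ≤ᵛ-+ᵛ : ∀ {k} (g m : Vec ℕ k) → g ≤ᵛ g +ᵛ m
  ≤ᵛ-+ᵛ [] [] = []
  ≤ᵛ-+ᵛ (x ∷ g) (y ∷ m) = m≤m+n x y ∷ ≤ᵛ-+ᵛ g m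

  ≤ᵛ-+ᵛʳ : ∀ {k} {g m : Vec ℕ k} (n : Vec ℕ k) → g ≤ᵛ m → g ≤ᵛ n +ᵛ m
  ≤ᵛ-+ᵛʳ [] [] = []
  ≤ᵛ-+ᵛʳ (z ∷ n) (p ∷ ps) = ≤-trans p (m≤n+m _ z) ∷ ≤ᵛ-+ᵛʳ n ps

  -- With its converse below, this is the adjunction between truncated subtraction and addition; it
  -- is why contracting by g replaces each h in the list by h ∸ g.
  ≤ᵛ-+⇒∸-≤ᵛ : ∀ {k} (h g m : Vec ℕ k) → h ≤ᵛ g +ᵛ m → h ∸ᵛ g ≤ᵛ m
  ≤ᵛ-+⇒∸-≤ᵛ [] [] [] [] = []
  ≤ᵛ-+⇒∸-≤ᵛ (x ∷ h) (y ∷ g) (_ ∷ m) (p ∷ ps) = m≤n+o⇒m∸n≤o x y p ∷ ≤ᵛ-+⇒∸-≤ᵛ h g m ps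

  ∸-≤ᵛ⇒≤ᵛ-+ : ∀ {k} (h g m : Vec ℕ k) → h ∸ᵛ g ≤ᵛ m → h ≤ᵛ g +ᵛ m
  ∸-≤ᵛ⇒≤ᵛ-+ [] [] [] [] = []
  ∸-≤ᵛ⇒≤ᵛ-+ (x ∷ h) (y ∷ g) (_ ∷ m) (p ∷ ps) =
    ≤-trans (m≤n+m∸n x y) (+-monoʳ-≤ y p) ∷ ∸-≤ᵛ⇒≤ᵛ-+ h g m ps

  <ˡ-irrefl : ∀ {k} {m : Vec ℕ k} → ¬ m <ˡ m
  <ˡ-irrefl = Lex.<-irrefl <-irrefl (Pointwise.refl refl)

  -- Translation invariance makes the set of non-least vectors upward closed.
  <ˡ-+ : ∀ {k} (r : Vec ℕ k) {m n} → m <ˡ n → r +ᵛ m <ˡ r +ᵛ n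
  <ˡ-+ [] (base ())
  <ˡ-+ (x ∷ r) {_ ∷ _} {_ ∷ _} (this p _) = this (+-monoʳ-< x p) refl
  <ˡ-+ (x ∷ r) {_ ∷ _} {_ ∷ _} (next p q) = next (cong (x +_) p) (<ˡ-+ r q)

  -- The order is total and compatible with addition, so a sum can descend only if a summand does.
  -- The first coordinates decide, unless they tie. This finds a descending generator inside a
  -- descending pair.
  <ˡ-+-reflects : ∀ {k} (m' n' m n : Vec ℕ k) → m' +ᵛ n' <ˡ m +ᵛ n → m' <ˡ m ⊎ n' <ˡ n
  <ˡ-+-reflects [] [] [] [] (base ())
  <ˡ-+-reflects (x' ∷ m') (y' ∷ n') (x ∷ m) (y ∷ n) lt with <-cmp x' x
  ... | tri< x'<x _ _ = inj₁ (this x'<x refl)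
  <ˡ-+-reflects (x' ∷ m') (y' ∷ n') (x ∷ m) (y ∷ n) (this p _) | tri> _ _ x<x' =
    inj₂ (this (+-cancelˡ-< x y' y (≤-<-trans (+-monoˡ-≤ y' (<⇒≤ x<x')) p)) refl)
  <ˡ-+-reflects (x' ∷ m') (y' ∷ n') (x ∷ m) (y ∷ n) (next p _) | tri> _ _ x<x' =
    inj₂ (this (+-cancelˡ-< x y' y (<-≤-trans (+-monoˡ-< y' x<x') (≤-reflexive p))) refl)
  <ˡ-+-reflects (x' ∷ m') (y' ∷ n') (x ∷ m) (y ∷ n) (this p _) | tri≈ _ refl _ =
    inj₂ (this (+-cancelˡ-< x y' y p) refl)
  <ˡ-+-reflects (x' ∷ m') (y' ∷ n') (x ∷ m) (y ∷ n) (next p q) | tri≈ _ refl _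
    with <ˡ-+-reflects m' n' m n q
  ... | inj₁ lt = inj₁ (next refl lt)
  ... | inj₂ lt = inj₂ (next (+-cancelˡ-≡ x y' y p) lt)

  -- Vectors of given weight outside a monomial ideal, and deletion-contraction

  Avoids : ∀ {k} → List (Vec ℕ k) → Vec ℕ k → Set
  Avoids G m = All (λ g → ¬ g ≤ᵛ m) G

  avoids? : ∀ {k} (G : List (Vec ℕ k)) → Decidable (Avoids G)
  avoids? G m = All.all? (λ g → ¬? (g ≤ᵛ? m)) G

  -- A finite search space for `dot w m ≡ n`: when all weights are positive, no coordinate of a
  -- solution exceeds n.
  box : ∀ k → ℕ → List (Vec ℕ k)
  box zero    n = [ [] ]
  box (suc k) n = cartesianProductWith _∷_ (upTo (suc n)) (box k n)

  box-unique : ∀ k n → Unique (box k n)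
  box-unique zero    n = [] ∷ []
  box-unique (suc k) n = Unique.cartesianProductWith⁺ _∷_ ∷-injective (Unique.upTo⁺ (suc n)) (box-unique k n)

  Positive : ∀ {k} → Vec ℕ k → Set
  Positive = VAll.All (0 <_)

  ∈-box : ∀ {k n} {w : Vec ℕ k} → Positive w → ∀ m → dot w m ≤ n → m ∈ box k n
  ∈-box [] [] _ = here refl
  ∈-box {n = n} {w = c ∷ w} (0<c ∷ pos) (x ∷ m) le =
    ∈-cartesianProductWith⁺ _∷_
      (∈-upTo⁺ (s≤s (≤-trans (m≤m*n x c {{>-nonZero 0<c}}) (≤-trans (m≤m+n (x * c) _) le))))
      (∈-box pos m (≤-trans (m≤n+m (dot w m) (x * c)) le))

  module _ {k} (w : Vec ℕ k) where

    solutions : List (Vec ℕ k) → ℕ → List (Vec ℕ k)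
    solutions G n = filter (avoids? G) (filter (λ m → dot w m ≟ n) (box k n))

    count : List (Vec ℕ k) → ℕ → ℕ
    count G n = length (solutions G n)

    solutions-unique : ∀ G n → Unique (solutions G n)
    solutions-unique G n = Unique.filter⁺ (avoids? G) (Unique.filter⁺ (λ m → dot w m ≟ n) (box-unique k n))

    ∈-solutions⁻ : ∀ {G n m} → m ∈ solutions G n → dot w m ≡ n × Avoids G m
    ∈-solutions⁻ {G} {n} m∈ with ∈-filter⁻ (avoids? G) m∈
    ... | m∈' , av = proj₂ (∈-filter⁻ (λ m → dot w m ≟ n) {xs = box k n} m∈') , av

    ∈-solutions⁺ : ∀ {G n m} → Positive w → dot w m ≡ n → Avoids G m → m ∈ solutions G n
    ∈-solutions⁺ {G} {n} {m} pos eq av =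
      ∈-filter⁺ (avoids? G) (∈-filter⁺ (λ m → dot w m ≟ n) (∈-box pos m (≤-reflexive eq)) eq) av

  -- Multiplication by q^j on coefficient sequences, with `z` as the zero coefficient. Recursion in
  -- place of a test `j ≤ n` lets its laws be proved by induction.
  shift : ∀ {A : Set} → A → ℕ → (ℕ → A) → ℕ → A
  shift z zero    a n       = a n
  shift z (suc j) a zero    = z
  shift z (suc j) a (suc n) = shift z j a n

  shift-≤ : ∀ {A : Set} {z : A} {j n} (a : ℕ → A) → j ≤ n → shift z j a n ≡ a (n ∸ j)
  shift-≤ a z≤n     = refl
  shift-≤ a (s≤s p) = shift-≤ a p

  shift-> : ∀ {A : Set} {z : A} {j n} (a : ℕ → A) → n < j → shift z j a n ≡ z
  shift-> {j = suc j} {zero}  a _ = refl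
  shift-> {j = suc j} {suc n} a (s≤s p) = shift-> {j = j} {n} a p

  avoids-+⁺ : ∀ {k} (g : Vec ℕ k) {G m} → Avoids (List.map (_∸ᵛ g) G) m → Avoids G (g +ᵛ m)
  avoids-+⁺ g {m = m} = All.map (λ {h} ¬le le → ¬le (≤ᵛ-+⇒∸-≤ᵛ h g m le)) ∘ All.map⁻

  avoids-+⁻ : ∀ {k} (g : Vec ℕ k) {G m} → Avoids G (g +ᵛ m) → Avoids (List.map (_∸ᵛ g) G) m
  avoids-+⁻ g {m = m} = All.map⁺ ∘ All.map (λ {h} ¬le le → ¬le (∸-≤ᵛ⇒≤ᵛ-+ h g m le))

  module _ {k} {w : Vec ℕ k} (pos : Positive w) where

    -- Deletion–contraction: the vectors avoiding G either avoid g as well, or are g plus a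
    -- vector avoiding all h ∸ g.
    count-∷ : ∀ g G n →
      count w G n ≡ count w (g ∷ G) n + shift 0 (dot w g) (count w (List.map (_∸ᵛ g) G)) n
    count-∷ g G n with dot w g ≤? n
    -- Here g is heavier than n: no vector of weight n lies above it, and the contracted term
    -- vanishes.
    ... | no ≰n = begin
      count w G n             ≡⟨ length-≡-sameMembers (solutions-unique w G n) (solutions-unique w (g ∷ G) n) to from ⟩
      count w (g ∷ G) n       ≡⟨ +-identityʳ _ ⟨
      count w (g ∷ G) n + 0   ≡⟨ cong (count w (g ∷ G) n +_) (shift-> (count w (List.map (_∸ᵛ g) G)) (≰⇒> ≰n)) ⟨
      _                       ∎
      where
      open ≡-Reasoning
      to : ∀ {m} → m ∈ solutions w G n → m ∈ solutions w (g ∷ G) n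
      to {m} m∈ with ∈-solutions⁻ w {G} m∈
      ... | eq , av = ∈-solutions⁺ w pos eq (¬g≤m ∷ av)
        where
        ¬g≤m : ¬ g ≤ᵛ m
        ¬g≤m g≤m = ≰n (≤-trans (m≤m+n (dot w g) (dot w (m ∸ᵛ g)))
                     (≤-reflexive (trans (sym (dot-+ w g (m ∸ᵛ g))) (trans (cong (dot w) (+ᵛ-∸ᵛ g≤m)) eq))))
      from : ∀ {m} → m ∈ solutions w (g ∷ G) n → m ∈ solutions w G n
      from m∈ with ∈-solutions⁻ w {g ∷ G} m∈
      ... | eq , _ ∷ av = ∈-solutions⁺ w pos eq av
    ... | yes ≤n = begin
      count w G n                                          ≡⟨ length-≡-sameMembers (solutions-unique w G n) split-unique to from ⟩
      length (solutions w (g ∷ G) n ++ List.map (g +ᵛ_) rest) ≡⟨ length-++ (solutions w (g ∷ G) n) ⟩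
      count w (g ∷ G) n + length (List.map (g +ᵛ_) rest)      ≡⟨ cong (count w (g ∷ G) n +_) (length-map _ rest) ⟩
      count w (g ∷ G) n + length rest                         ≡⟨ cong (count w (g ∷ G) n +_) (shift-≤ (count w G') ≤n) ⟨
      _                                                       ∎
      where
      open ≡-Reasoning
      G' = List.map (_∸ᵛ g) G
      rest = solutions w G' (n ∸ dot w g)
      split-unique : Unique (solutions w (g ∷ G) n ++ List.map (g +ᵛ_) rest)
      split-unique = Unique.++⁺ (solutions-unique w (g ∷ G) n)
        (Unique.map⁺ (+ᵛ-cancelˡ g) (solutions-unique w G' (n ∸ dot w g)))
        λ { (p , q) → case ∈-map⁻ (g +ᵛ_) q of λ { (m , _ , refl) →
            All.head (proj₂ (∈-solutions⁻ w {g ∷ G} p)) (≤ᵛ-+ᵛ g m) } }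
      to : ∀ {m} → m ∈ solutions w G n → m ∈ solutions w (g ∷ G) n ++ List.map (g +ᵛ_) rest
      to {m} m∈ with ∈-solutions⁻ w {G} m∈ | g ≤ᵛ? m
      ... | eq , av | no ¬le = ∈-++⁺ˡ (∈-solutions⁺ w pos eq (¬le ∷ av))
      ... | eq , av | yes le = ∈-++⁺ʳ (solutions w (g ∷ G) n)
        (subst (_∈ List.map (g +ᵛ_) rest) (+ᵛ-∸ᵛ le)
          (∈-map⁺ (g +ᵛ_) (∈-solutions⁺ w pos weight (avoids-+⁻ g (subst (Avoids G) (sym (+ᵛ-∸ᵛ le)) av)))))
        where
        weight : dot w (m ∸ᵛ g) ≡ n ∸ dot w g
        weight = sym (trans (cong (_∸ dot w g) (trans (sym eq) (trans (cong (dot w) (sym (+ᵛ-∸ᵛ le))) (dot-+ w g (m ∸ᵛ g)))))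
                            (m+n∸m≡n (dot w g) _))
      from : ∀ {m} → m ∈ solutions w (g ∷ G) n ++ List.map (g +ᵛ_) rest → m ∈ solutions w G n
      from m∈ with ∈-++⁻ (solutions w (g ∷ G) n) m∈
      ... | inj₁ p with ∈-solutions⁻ w {g ∷ G} p
      ...   | eq , _ ∷ av = ∈-solutions⁺ w pos eq av
      from m∈ | inj₂ p with ∈-map⁻ (g +ᵛ_) p
      ... | m' , m'∈ , refl with ∈-solutions⁻ w {G'} m'∈
      ...   | eq , av = ∈-solutions⁺ w pos
              (trans (dot-+ w g m') (trans (cong (dot w g +_) eq) (m+[n∸m]≡n ≤n))) (avoids-+⁺ g av)

  0ᵛ-≤ᵛ : ∀ {k} (m : Vec ℕ k) → 0ᵛ ≤ᵛ m
  0ᵛ-≤ᵛ [] = []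
  0ᵛ-≤ᵛ (x ∷ m) = z≤n ∷ 0ᵛ-≤ᵛ m

  -- Avoiding the first unit vector means having first coordinate 0.
  count-firstUnit : ∀ {k c} {w : Vec ℕ k} → 0 < c → Positive w → ∀ n →
                    count (c ∷ w) [ 1 ∷ 0ᵛ ] n ≡ count w [] n
  count-firstUnit {c = c} {w} 0<c pos n = trans
    (length-≡-sameMembers (solutions-unique (c ∷ w) _ n)
      (Unique.map⁺ (proj₂ ∘ ∷-injective) (solutions-unique w [] n)) to from)
    (length-map (0 ∷_) (solutions w [] n))
    where
    to : ∀ {m} → m ∈ solutions (c ∷ w) [ 1 ∷ 0ᵛ ] n → m ∈ List.map (0 ∷_) (solutions w [] n)
    to {zero ∷ m} m∈ = ∈-map⁺ (0 ∷_) (∈-solutions⁺ w pos (proj₁ (∈-solutions⁻ (c ∷ w) {[ 1 ∷ 0ᵛ ]} m∈)) [])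
    to {suc x ∷ m} m∈ with ∈-solutions⁻ (c ∷ w) {[ 1 ∷ 0ᵛ ]} m∈
    ... | _ , ¬le ∷ _ = contradiction (s≤s z≤n ∷ 0ᵛ-≤ᵛ m) ¬le
    from : ∀ {m} → m ∈ List.map (0 ∷_) (solutions w [] n) → m ∈ solutions (c ∷ w) [ 1 ∷ 0ᵛ ] n
    from m∈ with ∈-map⁻ (0 ∷_) m∈
    ... | m' , m'∈ , refl =
      ∈-solutions⁺ (c ∷ w) (0<c ∷ pos) (proj₁ (∈-solutions⁻ w {[]} m'∈)) ((λ { (() ∷ _) }) ∷ [])

  -- Deletion-contraction with the first unit vector. Contracting the empty list leaves it empty, so
  -- 1 - q^c takes the series of `c ∷ w` to that of `w`.
  count-all-∷ : ∀ {k c} {w : Vec ℕ k} → 0 < c → Positive w → ∀ n →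
                count (c ∷ w) [] n ≡ count w [] n + shift 0 c (count (c ∷ w) []) n
  count-all-∷ {c = c} {w} 0<c pos n = begin
    count (c ∷ w) [] n
      ≡⟨ count-∷ (0<c ∷ pos) (1 ∷ 0ᵛ) [] n ⟩
    count (c ∷ w) [ 1 ∷ 0ᵛ ] n + shift 0 (1 * c + dot w 0ᵛ) (count (c ∷ w) []) n
      ≡⟨ cong₂ (λ x j → x + shift 0 j (count (c ∷ w) []) n) (count-firstUnit 0<c pos n) unit-weight ⟩
    count w [] n + shift 0 c (count (c ∷ w) []) n ∎
    where
    open ≡-Reasoning
    unit-weight : 1 * c + dot w 0ᵛ ≡ c
    unit-weight = trans (cong₂ _+_ (*-identityˡ c) (dot-0 w)) (+-identityʳ c)

open Counting

-- Formal power series, and the numerator as a polynomial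

module PowerSeries where

  open import Data.Nat as ℕ using (ℕ; zero; suc; _≤_; z≤n; s≤s; _∸_; _≤?_)
  import Data.Nat.Properties as ℕ
  open import Data.Integer using (ℤ; +_; _+_; _-_; _*_)
  import Data.Integer.Properties as ℤ
  open import Data.Integer.Solver using (module +-*-Solver)
  open import Data.List.Properties using (length-map)
  open import Data.Vec.Relation.Unary.All using ([]; _∷_)
  open ≡-Reasoning

  shift-cong : ∀ {A : Set} {z : A} j {a b : ℕ → A} → a ≗ b → shift z j a ≗ shift z j b
  shift-cong zero    eq n       = eq n
  shift-cong (suc j) eq zero    = refl
  shift-cong (suc j) eq (suc n) = shift-cong j eq n

  shift-map : ∀ {A B : Set} {z : A} (f : A → B) j (a : ℕ → A) n →
              f (shift z j a n) ≡ shift (f z) j (λ i → f (a i)) n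
  shift-map f zero    a n       = refl
  shift-map f (suc j) a zero    = refl
  shift-map f (suc j) a (suc n) = shift-map f j a n

  shift-+ : ∀ {A : Set} {z : A} i j (a : ℕ → A) → shift z i (shift z j a) ≗ shift z (i ℕ.+ j) a
  shift-+ zero    j a n       = refl
  shift-+ (suc i) j a zero    = refl
  shift-+ (suc i) j a (suc n) = shift-+ i j a n

  shift-comm : ∀ {A : Set} {z : A} i j (a : ℕ → A) → shift z i (shift z j a) ≗ shift z j (shift z i a)
  shift-comm {z = z} i j a n = begin
    shift z i (shift z j a) n  ≡⟨ shift-+ i j a n ⟩
    shift z (i ℕ.+ j) a n      ≡⟨ cong (λ t → shift z t a n) (ℕ.+-comm i j) ⟩
    shift z (j ℕ.+ i) a n      ≡⟨ shift-+ j i a n ⟨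
    shift z j (shift z i a) n  ∎

  qShift : ℕ → (ℕ → ℤ) → ℕ → ℤ
  qShift = shift (+ 0)

  _⊖_ : (ℕ → ℤ) → (ℕ → ℤ) → ℕ → ℤ
  (a ⊖ b) n = a n - b n

  qShift-⊖ : ∀ j a b → qShift j (a ⊖ b) ≗ (qShift j a ⊖ qShift j b)
  qShift-⊖ zero    a b n       = refl
  qShift-⊖ (suc j) a b zero    = refl
  qShift-⊖ (suc j) a b (suc n) = qShift-⊖ j a b n

  mulOneMinusQ^-≗ : ∀ j a → mulOneMinusQ^ j a ≗ (a ⊖ qShift j a)
  mulOneMinusQ^-≗ j a n with j ≤? n
  ... | yes j≤n = cong (a n -_) (sym (shift-≤ a j≤n))
  ... | no  j≰n = sym (trans (cong (a n -_) (shift-> a (ℕ.≰⇒> j≰n))) (ℤ.+-identityʳ (a n)))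

  mulOneMinusQ^-cong : ∀ j {a b} → a ≗ b → mulOneMinusQ^ j a ≗ mulOneMinusQ^ j b
  mulOneMinusQ^-cong j {a} {b} eq n = begin
    mulOneMinusQ^ j a n    ≡⟨ mulOneMinusQ^-≗ j a n ⟩
    a n - qShift j a n     ≡⟨ cong₂ _-_ (eq n) (shift-cong j eq n) ⟩
    b n - qShift j b n     ≡⟨ mulOneMinusQ^-≗ j b n ⟨
    mulOneMinusQ^ j b n    ∎

  mulOneMinusQ^-⊖ : ∀ j a b → mulOneMinusQ^ j (a ⊖ b) ≗ (mulOneMinusQ^ j a ⊖ mulOneMinusQ^ j b)
  mulOneMinusQ^-⊖ j a b n = begin
    mulOneMinusQ^ j (a ⊖ b) n                      ≡⟨ mulOneMinusQ^-≗ j (a ⊖ b) n ⟩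
    a n - b n - qShift j (a ⊖ b) n                 ≡⟨ cong (λ x → a n - b n - x) (qShift-⊖ j a b n) ⟩
    a n - b n - (qShift j a n - qShift j b n)      ≡⟨ solve 4 (λ x y u v → x :- y :- (u :- v) := x :- u :- (y :- v)) refl
                                                         (a n) (b n) (qShift j a n) (qShift j b n) ⟩
    a n - qShift j a n - (b n - qShift j b n)      ≡⟨ cong₂ _-_ (mulOneMinusQ^-≗ j a n) (mulOneMinusQ^-≗ j b n) ⟨
    mulOneMinusQ^ j a n - mulOneMinusQ^ j b n      ∎
    where open +-*-Solver

  mulOneMinusQ^-qShift : ∀ j i a → mulOneMinusQ^ j (qShift i a) ≗ qShift i (mulOneMinusQ^ j a)
  mulOneMinusQ^-qShift j i a n = begin
    mulOneMinusQ^ j (qShift i a) n             ≡⟨ mulOneMinusQ^-≗ j (qShift i a) n ⟩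
    qShift i a n - qShift j (qShift i a) n     ≡⟨ cong (qShift i a n -_) (shift-comm j i a n) ⟩
    qShift i a n - qShift i (qShift j a) n     ≡⟨ qShift-⊖ i a (qShift j a) n ⟨
    qShift i (a ⊖ qShift j a) n                ≡⟨ shift-cong i (mulOneMinusQ^-≗ j a) n ⟨
    qShift i (mulOneMinusQ^ j a) n             ∎

  -- The product of the 1 - q^j as a composition of operators, whose commutation with shifts and
  -- with one another is a direct computation; `conv-prodOneMinusQ` leads back to convolution.
  mulProd : List ℕ → (ℕ → ℤ) → ℕ → ℤ
  mulProd []      a = a
  mulProd (j ∷ S) a = mulOneMinusQ^ j (mulProd S a)

  mulProd-cong : ∀ S {a b} → a ≗ b → mulProd S a ≗ mulProd S b
  mulProd-cong []      eq = eq
  mulProd-cong (j ∷ S) eq = mulOneMinusQ^-cong j (mulProd-cong S eq)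

  mulProd-⊖ : ∀ S a b → mulProd S (a ⊖ b) ≗ (mulProd S a ⊖ mulProd S b)
  mulProd-⊖ []      a b n = refl
  mulProd-⊖ (j ∷ S) a b n =
    trans (mulOneMinusQ^-cong j (mulProd-⊖ S a b) n) (mulOneMinusQ^-⊖ j (mulProd S a) (mulProd S b) n)

  mulProd-qShift : ∀ S i a → mulProd S (qShift i a) ≗ qShift i (mulProd S a)
  mulProd-qShift []      i a n = refl
  mulProd-qShift (j ∷ S) i a n =
    trans (mulOneMinusQ^-cong j (mulProd-qShift S i a) n) (mulOneMinusQ^-qShift j i (mulProd S a) n)

  mulProd-mulOneMinusQ^ : ∀ S j a → mulProd S (mulOneMinusQ^ j a) ≗ mulOneMinusQ^ j (mulProd S a)
  mulProd-mulOneMinusQ^ S j a n = begin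
    mulProd S (mulOneMinusQ^ j a) n              ≡⟨ mulProd-cong S (mulOneMinusQ^-≗ j a) n ⟩
    mulProd S (a ⊖ qShift j a) n                 ≡⟨ mulProd-⊖ S a (qShift j a) n ⟩
    mulProd S a n - mulProd S (qShift j a) n     ≡⟨ cong (mulProd S a n -_) (mulProd-qShift S j a n) ⟩
    mulProd S a n - qShift j (mulProd S a) n     ≡⟨ mulOneMinusQ^-≗ j (mulProd S a) n ⟨
    mulOneMinusQ^ j (mulProd S a) n              ∎

  sumℤ-cong : ∀ n {f g : ℕ → ℤ} → f ≗ g → sumℤ n f ≡ sumℤ n g
  sumℤ-cong zero    eq = refl
  sumℤ-cong (suc n) eq = cong₂ _+_ (sumℤ-cong n eq) (eq n)

  sumℤ-head : ∀ n f → sumℤ (suc n) f ≡ f 0 + sumℤ n (λ i → f (suc i))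
  sumℤ-head zero    f = trans (ℤ.+-identityˡ (f 0)) (sym (ℤ.+-identityʳ (f 0)))
  sumℤ-head (suc n) f = trans (cong (_+ f (suc n)) (sumℤ-head n f)) (ℤ.+-assoc (f 0) _ (f (suc n)))

  sumℤ-⊖ : ∀ n f g → sumℤ n (f ⊖ g) ≡ sumℤ n f - sumℤ n g
  sumℤ-⊖ zero    f g = refl
  sumℤ-⊖ (suc n) f g = begin
    sumℤ n (f ⊖ g) + (f n - g n)           ≡⟨ cong (_+ (f n - g n)) (sumℤ-⊖ n f g) ⟩
    sumℤ n f - sumℤ n g + (f n - g n)      ≡⟨ solve 4 (λ x y u v → x :- y :+ (u :- v) := x :+ u :- (y :+ v)) refl
                                                 (sumℤ n f) (sumℤ n g) (f n) (g n) ⟩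
    sumℤ n f + f n - (sumℤ n g + g n)      ∎
    where open +-*-Solver

  sumℤ-0 : ∀ n → sumℤ n (λ _ → + 0) ≡ + 0
  sumℤ-0 zero    = refl
  sumℤ-0 (suc n) = trans (ℤ.+-identityʳ _) (sumℤ-0 n)

  conv-one : ∀ b → conv one b ≗ b
  conv-one b n = begin
    conv one b n                                      ≡⟨ sumℤ-head n (λ i → one i * b (n ∸ i)) ⟩
    + 1 * b n + sumℤ n (λ i → + 0 * b (n ∸ suc i))    ≡⟨ cong₂ _+_ (ℤ.*-identityˡ (b n)) (sumℤ-cong n λ i → ℤ.*-zeroˡ (b (n ∸ suc i))) ⟩
    b n + sumℤ n (λ _ → + 0)                          ≡⟨ cong (λ x → b n + x) (sumℤ-0 n) ⟩
    b n + + 0                                         ≡⟨ ℤ.+-identityʳ (b n) ⟩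
    b n                                               ∎

  conv-cong : ∀ {a a'} b → a ≗ a' → conv a b ≗ conv a' b
  conv-cong b eq n = sumℤ-cong (suc n) (λ i → cong (_* b (n ∸ i)) (eq i))

  conv-⊖ : ∀ a a' b → conv (a ⊖ a') b ≗ (conv a b ⊖ conv a' b)
  conv-⊖ a a' b n = trans
    (sumℤ-cong (suc n) (λ i → solve 3 (λ x y z → (x :- y) :* z := x :* z :- y :* z) refl (a i) (a' i) (b (n ∸ i))))
    (sumℤ-⊖ (suc n) (λ i → a i * b (n ∸ i)) (λ i → a' i * b (n ∸ i)))
    where open +-*-Solver

  conv-qShift : ∀ j a b → conv (qShift j a) b ≗ qShift j (conv a b)
  conv-qShift zero    a b n       = refl
  conv-qShift (suc j) a b zero    = refl
  conv-qShift (suc j) a b (suc n) = begin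
    conv (qShift (suc j) a) b (suc n)                          ≡⟨ sumℤ-head (suc n) (λ i → qShift (suc j) a i * b (suc n ∸ i)) ⟩
    + 0 * b (suc n) + conv (qShift j a) b n                    ≡⟨ cong (_+ conv (qShift j a) b n) (ℤ.*-zeroˡ (b (suc n))) ⟩
    + 0 + conv (qShift j a) b n                                ≡⟨ ℤ.+-identityˡ _ ⟩
    conv (qShift j a) b n                                      ≡⟨ conv-qShift j a b n ⟩
    qShift j (conv a b) n                                      ∎

  conv-prodOneMinusQ : ∀ S b → conv (prodOneMinusQ S) b ≗ mulProd S b
  conv-prodOneMinusQ []      b n = conv-one b n
  conv-prodOneMinusQ (j ∷ S) b n = begin
    conv (mulOneMinusQ^ j P) b n                 ≡⟨ conv-cong b (mulOneMinusQ^-≗ j P) n ⟩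
    conv (P ⊖ qShift j P) b n                    ≡⟨ conv-⊖ P (qShift j P) b n ⟩
    conv P b n - conv (qShift j P) b n           ≡⟨ cong (conv P b n -_) (conv-qShift j P b n) ⟩
    conv P b n - qShift j (conv P b) n           ≡⟨ mulOneMinusQ^-≗ j (conv P b) n ⟨
    mulOneMinusQ^ j (conv P b) n                 ≡⟨ mulOneMinusQ^-cong j (conv-prodOneMinusQ S b) n ⟩
    mulOneMinusQ^ j (mulProd S b) n              ∎
    where P = prodOneMinusQ S

  -- These are the polynomials among the power series: `coeff-applyUpTo` turns the bound N into a
  -- list of coefficients.
  EventuallyZero : (ℕ → ℤ) → Set
  EventuallyZero a = Σ ℕ λ N → ∀ n → N ≤ n → a n ≡ + 0

  eventuallyZero-≗ : ∀ {a b} → a ≗ b → EventuallyZero b → EventuallyZero a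
  eventuallyZero-≗ eq (N , z) = N , λ n le → trans (eq n) (z n le)

  eventuallyZero-⊖ : ∀ {a b} → EventuallyZero a → EventuallyZero b → EventuallyZero (a ⊖ b)
  eventuallyZero-⊖ (N , za) (N' , zb) = N ℕ.+ N' , λ n le →
    cong₂ _-_ (za n (ℕ.≤-trans (ℕ.m≤m+n N N') le)) (zb n (ℕ.≤-trans (ℕ.m≤n+m N' N) le))

  eventuallyZero-qShift : ∀ j {a} → EventuallyZero a → EventuallyZero (qShift j a)
  eventuallyZero-qShift j {a} (N , z) = j ℕ.+ N , λ n le →
    trans (shift-≤ a (ℕ.≤-trans (ℕ.m≤m+n j N) le))
          (z (n ∸ j) (subst (_≤ n ∸ j) (ℕ.m+n∸m≡n j N) (ℕ.∸-monoˡ-≤ j le)))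

  coeff-applyUpTo : ∀ N a → (∀ n → N ≤ n → a n ≡ + 0) → ∀ n → a n ≡ coeff (applyUpTo a N) n
  coeff-applyUpTo zero    a z n       = z n z≤n
  coeff-applyUpTo (suc N) a z zero    = refl
  coeff-applyUpTo (suc N) a z (suc n) = coeff-applyUpTo N (λ i → a (suc i)) (λ i le → z (suc i) (s≤s le)) n

  countℤ : ∀ {k} → Vec ℕ k → List (Vec ℕ k) → ℕ → ℤ
  countℤ w G n = + count w G n

  +-recurrence⇒⊖ : ∀ (a b c : ℕ → ℕ) j → (∀ n → a n ≡ b n ℕ.+ shift 0 j c n) →
                      (λ n → + b n) ≗ ((λ n → + a n) ⊖ qShift j (λ n → + c n))
  +-recurrence⇒⊖ a b c j eq n = begin
    + b n                                                      ≡⟨ solve 2 (λ x y → x := x :+ y :- y) refl (+ b n) (+ shift 0 j c n) ⟩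
    + b n + + shift 0 j c n - + shift 0 j c n                  ≡⟨ cong (_- + shift 0 j c n) (ℤ.pos-+ (b n) (shift 0 j c n)) ⟨
    + (b n ℕ.+ shift 0 j c n) - + shift 0 j c n                ≡⟨ cong₂ (λ x y → + x - y) (sym (eq n)) (shift-map +_ j c n) ⟩
    + a n - qShift j (λ n → + c n) n                           ∎
    where open +-*-Solver

  -- The factor 1 - q^c is moved inside the product, where it acts directly on the series of `c ∷ w`
  -- and turns it into that of `w`.
  mulProd-count-all : ∀ {k} {w : Vec ℕ k} → Positive w → mulProd (toList w) (countℤ w []) ≗ one
  mulProd-count-all [] zero    = refl
  mulProd-count-all [] (suc n) = refl
  mulProd-count-all {w = c ∷ w} (0<c ∷ pos) n = begin
    mulOneMinusQ^ c (mulProd (toList w) (countℤ (c ∷ w) [])) n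
      ≡⟨ mulProd-mulOneMinusQ^ (toList w) c (countℤ (c ∷ w) []) n ⟨
    mulProd (toList w) (mulOneMinusQ^ c (countℤ (c ∷ w) [])) n
      ≡⟨ mulProd-cong (toList w) (mulOneMinusQ^-≗ c (countℤ (c ∷ w) [])) n ⟩
    mulProd (toList w) (countℤ (c ∷ w) [] ⊖ qShift c (countℤ (c ∷ w) [])) n
      ≡⟨ mulProd-cong (toList w) (+-recurrence⇒⊖ (count (c ∷ w) []) (count w []) (count (c ∷ w) []) c (count-all-∷ 0<c pos)) n ⟨
    mulProd (toList w) (countℤ w []) n
      ≡⟨ mulProd-count-all pos n ⟩
    one n ∎

  mulProd-count-eventuallyZero : ∀ {k} {w : Vec ℕ k} → Positive w → ∀ G →
                                 EventuallyZero (mulProd (toList w) (countℤ w G))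
  mulProd-count-eventuallyZero {k} {w} pos G = go (length G) G refl
    where
    S = toList w
    -- The recursion is on the length because the contracted list is as long as the tail of the
    -- given one without being a part of it.
    go : ∀ ℓ G → length G ≡ ℓ → EventuallyZero (mulProd S (countℤ w G))
    go zero [] _ = eventuallyZero-≗ (mulProd-count-all pos) (1 , λ { (suc n) _ → refl })
    go (suc ℓ) (g ∷ G) eq = eventuallyZero-≗ recurrence
      (eventuallyZero-⊖ (go ℓ G (ℕ.suc-injective eq))
        (eventuallyZero-qShift (dot w g) (go ℓ G' (trans (length-map _ G) (ℕ.suc-injective eq)))))
      where
      G' = List.map (_∸ᵛ g) G
      recurrence : mulProd S (countℤ w (g ∷ G)) ≗
                   (mulProd S (countℤ w G) ⊖ qShift (dot w g) (mulProd S (countℤ w G')))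
      recurrence n = begin
        mulProd S (countℤ w (g ∷ G)) n
          ≡⟨ mulProd-cong S (+-recurrence⇒⊖ (count w G) (count w (g ∷ G)) (count w G') (dot w g) (count-∷ pos g G)) n ⟩
        mulProd S (countℤ w G ⊖ qShift (dot w g) (countℤ w G')) n
          ≡⟨ mulProd-⊖ S (countℤ w G) (qShift (dot w g) (countℤ w G')) n ⟩
        mulProd S (countℤ w G) n - mulProd S (qShift (dot w g) (countℤ w G')) n
          ≡⟨ cong (mulProd S (countℤ w G) n -_) (mulProd-qShift S (dot w g) (countℤ w G') n) ⟩
        mulProd S (countℤ w G) n - qShift (dot w g) (mulProd S (countℤ w G')) n ∎

open PowerSeries

-- The monoid of pairs of multiplicity vectors

module Multinomials where

  open LinearDiophantine
  open import Data.Nat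
  open import Data.Nat.Properties
  open import Data.Nat.Induction using (<-wellFounded)
  open import Data.Nat.Divisibility using (_∣_; ∣-trans; ∣-refl; *-monoʳ-∣)
  open import Data.Nat.DivMod using (m/n*n≡m; /-congˡ; /-congʳ)
  open import Data.Nat.Combinatorics using ([n∸k]!k!∣n!)
  open import Data.Nat.ListAction using (sum; product)
  open import Data.Nat.ListAction.Properties using (sum-++; product-++; product-↭)
  open import Data.Nat.Primality using (Prime)
  open import Data.Nat.Primality.Factorisation using (PrimeFactorisation; factorise; factorisationUnique)
  open import Data.List.Properties using (length-++; filter-++; filter-none; filter-some)
  open import Data.List.Membership.Propositional.Properties
  open import Data.List.Membership.DecPropositional _≟_ using (_∈?_)
  import Data.List.Relation.Unary.All.Properties as All
  open import Data.List.Relation.Unary.Unique.DecPropositional.Properties _≟_ using (deduplicate-!)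
  open import Data.List.Relation.Binary.Permutation.Propositional using (_↭_)
  open import Data.List.Relation.Binary.Permutation.Propositional.Properties using (filter-↭; ↭-length) renaming (shift to ↭-shift)
  open import Data.Vec.Properties using (zipWith-assoc; zipWith-comm; zipWith-identityˡ; zipWith-identityʳ)
  open import Data.Vec.Relation.Unary.All using ([]; _∷_)
  open import Data.Vec.Relation.Binary.Pointwise.Inductive using (Pointwise-≡⇒≡)
  open import Data.Vec.Relation.Binary.Lex.Strict as Lex using ()
  open import Induction.WellFounded using (Acc; acc)
  open import Algebra.Structures using (IsCommutativeMonoid)

  VecPair : ℕ → Set
  VecPair k = Vec ℕ k × Vec ℕ k

  _+ᵖ_ : ∀ {k} → VecPair k → VecPair k → VecPair k
  (m , m') +ᵖ (n , n') = m +ᵛ n , m' +ᵛ n'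

  0ᵖ : ∀ {k} → VecPair k
  0ᵖ = 0ᵛ , 0ᵛ

  +ᵖ-isCommutativeMonoid : ∀ k → IsCommutativeMonoid _≡_ (_+ᵖ_ {k}) 0ᵖ
  +ᵖ-isCommutativeMonoid k = record
    { isMonoid = record
      { isSemigroup = record
        { isMagma = record { isEquivalence = isEquivalence ; ∙-cong = cong₂ _+ᵖ_ }
        ; assoc = λ (m , m') (n , n') (o , o') → cong₂ _,_ (zipWith-assoc +-assoc m n o) (zipWith-assoc +-assoc m' n' o') }
      ; identity = (λ (m , m') → cong₂ _,_ (zipWith-identityˡ +-identityˡ m) (zipWith-identityˡ +-identityˡ m'))
                 , (λ (m , m') → cong₂ _,_ (zipWith-identityʳ +-identityʳ m) (zipWith-identityʳ +-identityʳ m')) }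
    ; comm = λ (m , m') (n , n') → cong₂ _,_ (zipWith-comm +-comm m n) (zipWith-comm +-comm m' n') }

  module Pairs k = FinitelyGenerated (+ᵖ-isCommutativeMonoid k)

  units : ∀ k → List (VecPair k)
  units zero    = []
  units (suc k) = (1 ∷ 0ᵛ , 0ᵛ) ∷ (0ᵛ , 1 ∷ 0ᵛ) ∷ List.map (λ (m , n) → 0 ∷ m , 0 ∷ n) (units k)

  units-span : ∀ k v → Pairs.Span k (units k) v
  units-span zero    ([] , [])       = []
    where open Pairs zero
  units-span (suc k) (x ∷ m , y ∷ n) = go x y
    where
    open Pairs
    lift : ∀ {m n} → Span k (units k) (m , n) → Span (suc k) (units (suc k)) (0 ∷ m , 0 ∷ n)
    lift []       = []
    lift (p ∷ sp) = there (there (∈-map⁺ _ p)) ∷ lift sp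
    go : ∀ x y → Span (suc k) (units (suc k)) (x ∷ m , y ∷ n)
    go (suc x) y = subst (Span (suc k) _)
      (cong₂ (λ m n → suc x ∷ m , y ∷ n) (zipWith-identityˡ +-identityˡ m) (zipWith-identityˡ +-identityˡ n))
      (here refl ∷ go x y)
    go zero (suc y) = subst (Span (suc k) _)
      (cong₂ (λ m n → 0 ∷ m , suc y ∷ n) (zipWith-identityˡ +-identityˡ m) (zipWith-identityˡ +-identityˡ n))
      (there (here refl) ∷ go zero y)
    go zero zero = lift (units-span k (m , n))

  sameForm : ∀ {k} → Vec ℕ k → Pairs.Equation k
  sameForm {k} c = dot c ∘ proj₁ , dot c ∘ proj₂
    , record { 𝟎-homo = dot-0 c ; ⊕-homo = λ (m , _) (n , _) → dot-+ c m n }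
    , record { 𝟎-homo = dot-0 c ; ⊕-homo = λ (_ , m) (_ , n) → dot-+ c m n }

  Agree : ∀ {k} → List (Vec ℕ k) → Vec ℕ k → Vec ℕ k → Set
  Agree C m m' = All (λ c → dot c m ≡ dot c m') C

  -- Lexicographically least representatives of the classes under `Agree`

  module LexMinimal {k} (C : List (Vec ℕ k)) where

    open Pairs k

    basis-data : Σ (List (VecPair k)) λ B → All (λ x → All (Solves x) (List.map sameForm C)) B
                                          × (∀ {v} → All (Solves v) (List.map sameForm C) → Span B v)
    basis-data = solution-basis (List.map sameForm C) (units k) (units-span k)

    basis : List (VecPair k)
    basis = proj₁ basis-data

    basis-agree : ∀ {p p'} → (p , p') ∈ basis → Agree C p p'
    basis-agree x∈B = All.map⁻ (All.lookup (proj₁ (proj₂ basis-data)) x∈B)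

    basis-spans : ∀ {m m'} → Agree C m m' → Span basis (m , m')
    basis-spans agree = proj₂ (proj₂ basis-data) (All.map⁺ agree)

    descends? : (x : VecPair k) → Dec (proj₂ x <ˡ proj₁ x)
    descends? (p , p') = p' <ˡ? p

    -- Generators of the monomial ideal of all m that are not lexicographically least in their class.
    leading : List (Vec ℕ k)
    leading = List.map proj₁ (filter descends? basis)

    -- In `m = r + p` the part p is exchanged for the smaller p' of its generating pair: all forms
    -- keep their values, and translation invariance makes the result smaller.
    leading-≤⇒descends : ∀ {m g} → g ∈ leading → g ≤ᵛ m → ∃ λ m' → Agree C m m' × m' <ˡ m
    leading-≤⇒descends {m} g∈ g≤m with ∈-map⁻ proj₁ g∈
    ... | (p , p') , x∈ , refl with ∈-filter⁻ descends? x∈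
    ... | x∈B , p'<p = r +ᵛ p'
        , All.map (λ {c} eq → subst (λ t → dot c t ≡ dot c (r +ᵛ p')) r+p≡m
                    (trans (dot-+ c r p) (trans (cong (dot c r +_) eq) (sym (dot-+ c r p'))))) (basis-agree x∈B)
        , subst (r +ᵛ p' <ˡ_) r+p≡m (<ˡ-+ r p'<p)
      where
      r = m ∸ᵛ p
      r+p≡m : r +ᵛ p ≡ m
      r+p≡m = trans (zipWith-comm +-comm r p) (+ᵛ-∸ᵛ g≤m)

    -- Decompose `(m , m')` into generators. By `<ˡ-+-reflects` one of them descends, and its first
    -- component lies below `m`.
    descends⇒leading-≤ : ∀ {m m'} → Agree C m m' → m' <ˡ m → Any (_≤ᵛ m) leading
    descends⇒leading-≤ agree m'<m with go (basis-spans agree)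
      where
      go : ∀ {v} → Span basis v → Any (_≤ᵛ proj₁ v) leading ⊎ ¬ (proj₂ v <ˡ proj₁ v)
      go [] = inj₂ <ˡ-irrefl
      go (_∷_ {x@(p , p')} {v@(q , q')} x∈ sp) with descends? x | go sp
      ... | yes p'<p | _ = inj₁ (lose (∈-map⁺ proj₁ (∈-filter⁺ descends? x∈ p'<p)) (≤ᵛ-+ᵛ p q))
      ... | no _    | inj₁ any = inj₁ (Any.map (≤ᵛ-+ᵛʳ p) any)
      ... | no p'≮p | inj₂ q'≮q = inj₂ λ lt → case <ˡ-+-reflects p' q' p q lt of λ
        { (inj₁ p'<p) → p'≮p p'<p ; (inj₂ q'<q) → q'≮q q'<q }
    ... | inj₁ any = any
    ... | inj₂ m'≮m = contradiction m'<m m'≮m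

    ¬avoids⇒any : ∀ {G : List (Vec ℕ k)} {m} → ¬ Avoids G m → Any (_≤ᵛ m) G
    ¬avoids⇒any {G} {m} ¬av with Any.any? (_≤ᵛ? m) G
    ... | yes any = any
    ... | no ¬any = contradiction (All.¬Any⇒All¬ G ¬any) ¬av

    agree-trans : ∀ {m n o : Vec ℕ k} → Agree C m n → Agree C n o → Agree C m o
    agree-trans p q = All.zipWith (λ (x , y) → trans x y) (p , q)

    -- Descent: a vector above a leading one has a smaller vector in its class, and the
    -- lexicographic order on vectors of fixed length is well-founded.
    representative : ∀ m → ∃ λ m' → Agree C m m' × Avoids leading m'
    representative m = go m (Lex.<-wellFounded trans (subst (_ <_)) <-wellFounded m)
      where
      go : ∀ m → Acc _<ˡ_ m → ∃ λ m' → Agree C m m' × Avoids leading m'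
      go m (acc rec) with avoids? leading m
      ... | yes av = m , All.tabulate (λ _ → refl) , av
      ... | no ¬av with find (¬avoids⇒any ¬av)
      ... | g , g∈ , g≤m with leading-≤⇒descends g∈ g≤m
      ... | m' , agree , m'<m with go m' (rec m'<m)
      ... | m'' , agree' , av = m'' , agree-trans agree agree' , av

    agree-sym : ∀ {m n} → Agree C m n → Agree C n m
    agree-sym = All.map sym

    -- Of two distinct vectors in one class, the larger lies above a leading vector.
    representative-unique : ∀ {m m'} → Avoids leading m → Avoids leading m' → Agree C m m' → m ≡ m'
    representative-unique {m} {m'} av av' agree with Lex.<-cmp sym <-cmp m m'
    ... | tri≈ _ eq _ = Pointwise-≡⇒≡ eq
    ... | tri< m<m' _ _ = contradiction (descends⇒leading-≤ (agree-sym agree) m<m') (All.All¬⇒¬Any av')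
    ... | tri> _ _ m'<m = contradiction (descends⇒leading-≤ agree m'<m) (All.All¬⇒¬Any av)

  -- Partitions as multiplicity vectors, and coincidences of multinomial coefficients

  expand : ∀ {k} → Vec ℕ k → Vec ℕ k → List ℕ
  expand []      []       = []
  expand (s ∷ w) (m ∷ ms) = List.replicate m s ++ expand w ms

  ∈-partitionsIn⁻ : ∀ {k} (w : Vec ℕ k) {n λs} → λs ∈ partitionsIn (toList w) n →
                    ∃ λ m → dot w m ≡ n × λs ≡ expand w m
  ∈-partitionsIn⁻ [] {zero} (here refl) = [] , refl , refl
  ∈-partitionsIn⁻ (s ∷ w) {n} p
    with find (∈-concatMap⁻ (λ m → List.map (List.replicate m s ++_) (partitionsIn (toList w) (n ∸ m * s)))
                            {xs = filter (λ m → m * s ≤? n) (upTo (suc n))} p)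
  ... | m , m∈ , q with ∈-map⁻ (List.replicate m s ++_) q
  ... | μs , μs∈ , refl with ∈-partitionsIn⁻ w μs∈
  ... | ms , eq , refl = m ∷ ms
      , trans (cong (m * s +_) eq) (m+[n∸m]≡n (proj₂ (∈-filter⁻ (λ m → m * s ≤? n) {xs = upTo (suc n)} m∈)))
      , refl

  ∈-partitionsIn⁺ : ∀ {k} {w : Vec ℕ k} → Positive w → ∀ m → expand w m ∈ partitionsIn (toList w) (dot w m)
  ∈-partitionsIn⁺ [] [] = here refl
  ∈-partitionsIn⁺ {w = s ∷ w} (0<s ∷ pos) (m ∷ ms) =
    ∈-concatMap⁺ (λ m → List.map (List.replicate m s ++_) (partitionsIn (toList w) (n ∸ m * s)))
      (lose (∈-filter⁺ (λ m → m * s ≤? n) (∈-upTo⁺ (s≤s (≤-trans (m≤m*n m s {{>-nonZero 0<s}}) m*s≤n))) m*s≤n)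
            (∈-map⁺ (List.replicate m s ++_)
              (subst (λ t → expand w ms ∈ partitionsIn (toList w) t) (sym (m+n∸m≡n (m * s) (dot w ms)))
                (∈-partitionsIn⁺ pos ms))))
    where
    n = m * s + dot w ms
    m*s≤n : m * s ≤ n
    m*s≤n = m≤m+n (m * s) (dot w ms)

  sum-expand : ∀ {k} (w m : Vec ℕ k) → sum (expand w m) ≡ dot w m
  sum-expand [] [] = refl
  sum-expand (s ∷ w) (m ∷ ms) =
    trans (sum-++ (List.replicate m s) (expand w ms)) (cong₂ _+_ (sum-replicate m) (sum-expand w ms))
    where
    sum-replicate : ∀ m → sum (List.replicate m s) ≡ m * s
    sum-replicate zero    = refl
    sum-replicate (suc m) = cong (s +_) (sum-replicate m)

  -- One part is split off at a time, the quotient being a binomial coefficient. This makes the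
  -- division in `multinomial` exact.
  prodFact∣sum! : ∀ xs → prodFact xs ∣ sum xs !
  prodFact∣sum! []       = ∣-refl
  prodFact∣sum! (x ∷ xs) = ∣-trans (*-monoʳ-∣ (x !) (prodFact∣sum! xs))
    (subst (λ t → t ! * sum xs ! ∣ (x + sum xs) !) (m+n∸n≡m x (sum xs)) ([n∸k]!k!∣n! (m≤n+m (sum xs) x)))

  multinomial*prodFact : ∀ xs → multinomial xs * prodFact xs ≡ sum xs !
  multinomial*prodFact xs = m/n*n≡m {{prodFact≢0 xs}} (prodFact∣sum! xs)

  multinomial-cong : ∀ {xs ys} → sum xs ≡ sum ys → prodFact xs ≡ prodFact ys → multinomial xs ≡ multinomial ys
  multinomial-cong {xs} {ys} s p = trans
    (/-congˡ {{prodFact≢0 xs}} (cong _! s))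
    (/-congʳ {{prodFact≢0 xs}} {{prodFact≢0 ys}} p)

  multinomial-injective : ∀ {xs ys} → sum xs ≡ sum ys → multinomial xs ≡ multinomial ys → prodFact xs ≡ prodFact ys
  multinomial-injective {xs} {ys} s eq = *-cancelˡ-≡ (prodFact xs) (prodFact ys) (multinomial xs) {{multinomial≢0}} (begin
    multinomial xs * prodFact xs  ≡⟨ multinomial*prodFact xs ⟩
    sum xs !                      ≡⟨ cong _! s ⟩
    sum ys !                      ≡⟨ multinomial*prodFact ys ⟨
    multinomial ys * prodFact ys  ≡⟨ cong (_* prodFact ys) eq ⟨
    multinomial xs * prodFact ys  ∎)
    where
    open ≡-Reasoning
    multinomial≢0 : NonZero (multinomial xs)
    multinomial≢0 = m*n≢0⇒m≢0 (multinomial xs) {{subst NonZero (sym (multinomial*prodFact xs)) (sum xs !≢0)}}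

  occurrences : ℕ → List ℕ → ℕ
  occurrences p xs = length (filter (p ≟_) xs)

  occurrences-++ : ∀ p xs ys → occurrences p (xs ++ ys) ≡ occurrences p xs + occurrences p ys
  occurrences-++ p xs ys = trans (cong length (filter-++ (p ≟_) xs ys)) (length-++ (filter (p ≟_) xs))

  occurrences-↭ : ∀ p {xs ys} → xs ↭ ys → occurrences p xs ≡ occurrences p ys
  occurrences-↭ p xs↭ys = ↭-length (filter-↭ (p ≟_) xs↭ys)

  occurrences-∉ : ∀ {p xs} → p ∉ xs → occurrences p xs ≡ 0
  occurrences-∉ {p} {xs} p∉xs = cong length (filter-none (p ≟_) (All.¬Any⇒All¬ xs p∉xs))

  occurrences-∈ : ∀ {p xs} → p ∈ xs → 0 < occurrences p xs
  occurrences-∈ {p} p∈xs = filter-some (p ≟_) p∈xs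

  product-occurrences : ∀ xs ys → (∀ p → occurrences p xs ≡ occurrences p ys) → product xs ≡ product ys
  product-occurrences [] [] _ = refl
  product-occurrences [] (y ∷ ys) eq = contradiction (eq y) (<⇒≢ (occurrences-∈ {xs = y ∷ ys} (here refl)))
  product-occurrences (x ∷ xs) ys eq with x ∈? ys
  ... | no x∉ys = contradiction (trans (sym (occurrences-∉ x∉ys)) (sym (eq x))) (<⇒≢ (occurrences-∈ {xs = x ∷ xs} (here refl)))
  ... | yes x∈ys with ∈-∃++ x∈ys
  ... | as , bs , refl = trans (cong (x *_) (product-occurrences xs (as ++ bs) eq')) (sym (product-↭ (↭-shift x as bs)))
    where
    eq' : ∀ p → occurrences p xs ≡ occurrences p (as ++ bs)
    eq' p = +-cancelˡ-≡ (occurrences p [ x ]) _ _ (begin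
      occurrences p [ x ] + occurrences p xs          ≡⟨ occurrences-++ p [ x ] xs ⟨
      occurrences p (x ∷ xs)                          ≡⟨ eq p ⟩
      occurrences p (as ++ x ∷ bs)                    ≡⟨ occurrences-↭ p (↭-shift x as bs) ⟩
      occurrences p (x ∷ as ++ bs)                    ≡⟨ occurrences-++ p [ x ] (as ++ bs) ⟩
      occurrences p [ x ] + occurrences p (as ++ bs)  ∎)
      where open ≡-Reasoning

  factorialFactorisation : ∀ s → PrimeFactorisation (s !)
  factorialFactorisation s = factorise (s !) {{s !≢0}}

  factorialPrimes : ℕ → List ℕ
  factorialPrimes s = PrimeFactorisation.factors (factorialFactorisation s)

  -- The primes are collected part by part, so that the exponent of each prime is a linear form in
  -- the multiplicities.
  primeList : List ℕ → List ℕ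
  primeList = concatMap factorialPrimes

  primeList-factorisation : ∀ xs → PrimeFactorisation (prodFact xs)
  primeList-factorisation xs = record
    { factors = primeList xs ; isFactorisation = sym (product-primeList xs) ; factorsPrime = all-prime xs }
    where
    product-primeList : ∀ xs → product (primeList xs) ≡ prodFact xs
    product-primeList []       = refl
    product-primeList (x ∷ xs) = trans (product-++ (factorialPrimes x) (primeList xs))
      (cong₂ _*_ (sym (PrimeFactorisation.isFactorisation (factorialFactorisation x))) (product-primeList xs))
    all-prime : ∀ xs → All Prime (primeList xs)
    all-prime []       = []
    all-prime (x ∷ xs) = All.++⁺ (PrimeFactorisation.factorsPrime (factorialFactorisation x)) (all-prime xs)

  occurrenceForm : ∀ {k} → Vec ℕ k → ℕ → Vec ℕ k
  occurrenceForm w p = Vec.map (occurrences p ∘ factorialPrimes) w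

  occurrences-primeList : ∀ {k} (w : Vec ℕ k) p m →
                          occurrences p (primeList (expand w m)) ≡ dot (occurrenceForm w p) m
  occurrences-primeList [] p [] = refl
  occurrences-primeList (s ∷ w) p (zero ∷ ms) = occurrences-primeList w p ms
  occurrences-primeList (s ∷ w) p (suc m ∷ ms) = begin
    occurrences p (factorialPrimes s ++ primeList (expand (s ∷ w) (m ∷ ms)))
      ≡⟨ occurrences-++ p (factorialPrimes s) _ ⟩
    o + occurrences p (primeList (expand (s ∷ w) (m ∷ ms)))
      ≡⟨ cong (o +_) (occurrences-primeList (s ∷ w) p (m ∷ ms)) ⟩
    o + (m * o + dot (occurrenceForm w p) ms)
      ≡⟨ +-assoc o (m * o) _ ⟨
    suc m * o + dot (occurrenceForm w p) ms ∎
    where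
    open ≡-Reasoning
    o = occurrences p (factorialPrimes s)

  -- Whatever the multiplicities, only primes dividing some s! occur; this is why finitely many
  -- forms control all exponents.
  primeList-expand-⊆ : ∀ {k} (w m : Vec ℕ k) {p} → p ∈ primeList (expand w m) → p ∈ primeList (toList w)
  primeList-expand-⊆ []      []           ()
  primeList-expand-⊆ (s ∷ w) (zero ∷ ms)  p∈ = ∈-++⁺ʳ (factorialPrimes s) (primeList-expand-⊆ w ms p∈)
  primeList-expand-⊆ (s ∷ w) (suc m ∷ ms) p∈ =
    [ ∈-++⁺ˡ , primeList-expand-⊆ (s ∷ w) (m ∷ ms) ]′ (∈-++⁻ (factorialPrimes s) p∈)

  -- Among multiplicity vectors, these forms separate exactly the pairs (n, n!/∏ s!^m): they are the
  -- total n and the exponents of the primes in ∏ s!^m.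
  forms : ∀ {k} → Vec ℕ k → List (Vec ℕ k)
  forms w = w ∷ List.map (occurrenceForm w) (primeList (toList w))

  module _ {k} {w m m' : Vec ℕ k} where

    private
      xs = expand w m
      ys = expand w m'

    agree⇒sum : Agree (forms w) m m' → sum xs ≡ sum ys
    agree⇒sum (weight ∷ _) = trans (sum-expand w m) (trans weight (sym (sum-expand w m')))

    agree⇒multinomial : Agree (forms w) m m' → multinomial xs ≡ multinomial ys
    agree⇒multinomial agree@(_ ∷ occ) = multinomial-cong {xs} {ys} (agree⇒sum agree) (begin
      prodFact xs              ≡⟨ PrimeFactorisation.isFactorisation (primeList-factorisation xs) ⟩
      product (primeList xs)   ≡⟨ product-occurrences (primeList xs) (primeList ys) sameOccurrences ⟩
      product (primeList ys)   ≡⟨ PrimeFactorisation.isFactorisation (primeList-factorisation ys) ⟨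
      prodFact ys              ∎)
      where
      open ≡-Reasoning
      sameOccurrences : ∀ p → occurrences p (primeList xs) ≡ occurrences p (primeList ys)
      sameOccurrences p with p ∈? primeList (toList w)
      ... | yes p∈ = trans (occurrences-primeList w p m)
                       (trans (All.lookup (All.map⁻ occ) p∈) (sym (occurrences-primeList w p m')))
      ... | no p∉ = trans (occurrences-∉ (p∉ ∘ primeList-expand-⊆ w m)) (sym (occurrences-∉ (p∉ ∘ primeList-expand-⊆ w m')))

    multinomial⇒agree : dot w m ≡ dot w m' → multinomial xs ≡ multinomial ys → Agree (forms w) m m'
    multinomial⇒agree weight eq = weight ∷ All.map⁺ (All.tabulate λ {p} _ → begin
      dot (occurrenceForm w p) m       ≡⟨ occurrences-primeList w p m ⟨
      occurrences p (primeList xs)     ≡⟨ occurrences-↭ p samePrimes ⟩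
      occurrences p (primeList ys)     ≡⟨ occurrences-primeList w p m' ⟩
      dot (occurrenceForm w p) m'      ∎)
      where
      open ≡-Reasoning
      sameProduct : prodFact xs ≡ prodFact ys
      sameProduct = multinomial-injective {xs} {ys} (trans (sum-expand w m) (trans weight (sym (sum-expand w m')))) eq
      samePrimes : primeList xs ↭ primeList ys
      samePrimes = factorisationUnique
        (record { factors = primeList xs
                ; isFactorisation = trans (sym sameProduct) (PrimeFactorisation.isFactorisation (primeList-factorisation xs))
                ; factorsPrime = PrimeFactorisation.factorsPrime (primeList-factorisation xs) })
        (primeList-factorisation ys)

  -- Pair v with m when `v ≡ value m`. Each value is attained at the representative of any vector
  -- attaining it, and two avoiding vectors with equal weight and value agree on all forms, so they
  -- coincide.
  M≡count : ∀ {k} {w : Vec ℕ k} → Positive w → ∀ n → M (toList w) n ≡ count w (LexMinimal.leading (forms w)) n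
  M≡count {k} {w} pos n = ≤-antisym
    (length-≤-injection (λ v m → v ≡ value m) (deduplicate-! values) to (λ _ _ p q → trans p (sym q)))
    (length-≤-injection (λ m v → v ≡ value m) (solutions-unique w leading n) from injective)
    where
    open LexMinimal (forms w)
    value : Vec ℕ k → ℕ
    value m = multinomial (expand w m)
    values : List ℕ
    values = List.map multinomial (partitionsIn (toList w) n)
    to : ∀ {v} → v ∈ deduplicate _≟_ values → ∃ λ m → m ∈ solutions w leading n × v ≡ value m
    to v∈ with ∈-map⁻ multinomial (∈-deduplicate⁻ _≟_ values v∈)
    ... | λs , λs∈ , refl with ∈-partitionsIn⁻ w λs∈
    ... | m , weight , refl with representative m
    ... | m' , agree , av = m'
      , ∈-solutions⁺ w pos (trans (sym (All.head agree)) weight) av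
      , agree⇒multinomial agree
    from : ∀ {m} → m ∈ solutions w leading n → ∃ λ v → v ∈ deduplicate _≟_ values × v ≡ value m
    from {m} m∈ with ∈-solutions⁻ w {leading} m∈
    ... | refl , _ = value m , ∈-deduplicate⁺ _≟_ (∈-map⁺ multinomial (∈-partitionsIn⁺ pos m)) , refl
    injective : ∀ {m m' v} → m ∈ solutions w leading n → m' ∈ solutions w leading n →
                v ≡ value m → v ≡ value m' → m ≡ m'
    injective m∈ m'∈ p q with ∈-solutions⁻ w {leading} m∈ | ∈-solutions⁻ w {leading} m'∈
    ... | weight , av | weight' , av' = representative-unique av av'
      (multinomial⇒agree (trans weight (sym weight')) (trans (sym p) q))

open Multinomials

-- Periodic functions, quasipolynomials and their antidifferences

module Quasipolynomials where

  open import Data.Nat as ℕ using (ℕ; zero; suc; _≤_; _<_; s≤s; _^_)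
  import Data.Nat.Properties as ℕ
  import Data.Nat.Solver as ℕ
  open import Data.Nat.Divisibility using (_∣_)
  open import Data.Integer as ℤ using (ℤ; +_)
  import Data.Integer.Properties as ℤ
  import Data.Integer.Solver as ℤ
  open import Data.Rational as ℚ using (ℚ; 0ℚ; 1ℚ; _+_; _*_; _-_; -_; toℚᵘ)
  import Data.Rational.Properties as ℚ
  open import Data.Rational.Unnormalised as ℚᵘ using (mkℚᵘ; *≡*)
  import Data.Rational.Unnormalised.Properties as ℚᵘ
  open import Data.Rational.Solver using (module +-*-Solver)
  open import Algebra.Properties.Group ℚ.+-0-group using (∙-cancelʳ)
  open import Data.Fin using (Fin; zero; suc; toℕ)

  ℤtoℚ : ℤ → ℚ
  ℤtoℚ z = z ℚ./ 1

  ℤtoℚ-+ : ∀ x y → ℤtoℚ (x ℤ.+ y) ≡ ℤtoℚ x + ℤtoℚ y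
  ℤtoℚ-+ x y = ℚ.toℚᵘ-injective (begin-equality
    toℚᵘ (ℤtoℚ (x ℤ.+ y))                 ≃⟨ ℚ.toℚᵘ-fromℚᵘ (mkℚᵘ (x ℤ.+ y) 0) ⟩
    mkℚᵘ (x ℤ.+ y) 0                      ≃⟨ *≡* (solve 2 (λ x y → (x :+ y) :* con (+ 1) := (x :* con (+ 1) :+ y :* con (+ 1)) :* con (+ 1)) refl x y) ⟩
    mkℚᵘ x 0 ℚᵘ.+ mkℚᵘ y 0                ≃⟨ ℚᵘ.+-cong (ℚ.toℚᵘ-fromℚᵘ (mkℚᵘ x 0)) (ℚ.toℚᵘ-fromℚᵘ (mkℚᵘ y 0)) ⟨
    toℚᵘ (ℤtoℚ x) ℚᵘ.+ toℚᵘ (ℤtoℚ y)      ≃⟨ ℚ.toℚᵘ-homo-+ (ℤtoℚ x) (ℤtoℚ y) ⟨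
    toℚᵘ (ℤtoℚ x + ℤtoℚ y)                ∎)
    where
    open ℚᵘ.≤-Reasoning
    open ℤ.+-*-Solver

  ℤtoℚ-* : ∀ x y → ℤtoℚ (x ℤ.* y) ≡ ℤtoℚ x * ℤtoℚ y
  ℤtoℚ-* x y = ℚ.toℚᵘ-injective (begin-equality
    toℚᵘ (ℤtoℚ (x ℤ.* y))                 ≃⟨ ℚ.toℚᵘ-fromℚᵘ (mkℚᵘ (x ℤ.* y) 0) ⟩
    mkℚᵘ x 0 ℚᵘ.* mkℚᵘ y 0                ≃⟨ ℚᵘ.*-cong (ℚ.toℚᵘ-fromℚᵘ (mkℚᵘ x 0)) (ℚ.toℚᵘ-fromℚᵘ (mkℚᵘ y 0)) ⟨
    toℚᵘ (ℤtoℚ x) ℚᵘ.* toℚᵘ (ℤtoℚ y)      ≃⟨ ℚ.toℚᵘ-homo-* (ℤtoℚ x) (ℤtoℚ y) ⟨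
    toℚᵘ (ℤtoℚ x * ℤtoℚ y)                ∎)
    where open ℚᵘ.≤-Reasoning

  -- Opaque, so that the normalisation of fractions in `ℕtoℚ` does not unfold in the ring
  -- computations; outside, `ι` is known by the laws of this block.
  opaque
    ι : ℕ → ℚ
    ι = ℕtoℚ

    ι≡ℕtoℚ : ∀ n → ι n ≡ ℕtoℚ n
    ι≡ℕtoℚ n = refl

    ι-0 : ι 0 ≡ 0ℚ
    ι-0 = refl

    ι-1 : ι 1 ≡ 1ℚ
    ι-1 = refl

    ι-+ : ∀ m n → ι (m ℕ.+ n) ≡ ι m + ι n
    ι-+ m n = trans (cong ℤtoℚ (ℤ.pos-+ m n)) (ℤtoℚ-+ (+ m) (+ n))

    ι-* : ∀ m n → ι (m ℕ.* n) ≡ ι m * ι n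
    ι-* m n = trans (cong ℤtoℚ (ℤ.pos-* m n)) (ℤtoℚ-* (+ m) (+ n))

    ι-inverse : ∀ c → 0 < c → Σ ℚ λ κ → κ * ι c ≡ 1ℚ
    ι-inverse c 0<c = (ℚ.1/ ℕtoℚ c) {{ℕtoℚ≢0}} , ℚ.*-inverseˡ (ℕtoℚ c) {{ℕtoℚ≢0}}
      where
      ℕtoℚ≢0 : ℚ.NonZero (ℕtoℚ c)
      ℕtoℚ≢0 = ℚ.pos⇒nonZero (ℕtoℚ c) {{ℚ.normalize-pos c 1 {{_}} {{ℕ.>-nonZero 0<c}}}}

  open ≡-Reasoning

  Periodic : ℕ → (ℕ → ℚ) → Set
  Periodic d g = ∀ n → g (n ℕ.+ d) ≡ g n

  periodic-multiple : ∀ {d g} → Periodic d g → ∀ k n → g (n ℕ.+ k ℕ.* d) ≡ g n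
  periodic-multiple {d} {g} per zero    n = cong g (ℕ.+-identityʳ n)
  periodic-multiple {d} {g} per (suc k) n = begin
    g (n ℕ.+ (d ℕ.+ k ℕ.* d))   ≡⟨ cong g (ℕ.+-assoc n d (k ℕ.* d)) ⟨
    g (n ℕ.+ d ℕ.+ k ℕ.* d)     ≡⟨ periodic-multiple per k (n ℕ.+ d) ⟩
    g (n ℕ.+ d)                 ≡⟨ per n ⟩
    g n                         ∎

  periodic-translate : ∀ {d g} t → Periodic d g → Periodic d (λ n → g (n ℕ.+ t))
  periodic-translate {d} {g} t per n = trans (cong g (solve 3 (λ n d t → n :+ d :+ t := n :+ t :+ d) refl n d t)) (per (n ℕ.+ t))
    where open ℕ.+-*-Solver

  -- The weights 0, 1, ..., d - 1 along a closed orbit form a sawtooth: one step lowers every weight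
  -- by 1, except at the point that wraps around, whose weight rises by d - 1. Hence `weightedSum d`
  -- divided by d has s-difference g minus its mean.
  module Averaging (s : ℕ) (g : ℕ → ℚ) where

    orbitSum : ℕ → ℕ → ℚ
    orbitSum zero    n = 0ℚ
    orbitSum (suc N) n = orbitSum N n + g (n ℕ.+ N ℕ.* s)

    weightedSum : ℕ → ℕ → ℚ
    weightedSum zero    n = 0ℚ
    weightedSum (suc N) n = weightedSum N n + ι N * g (n ℕ.+ N ℕ.* s)

    private
      next : ∀ n N → g (n ℕ.+ s ℕ.+ N ℕ.* s) ≡ g (n ℕ.+ suc N ℕ.* s)
      next n N = cong g (ℕ.+-assoc n s (N ℕ.* s))

    -- This and `weightedSum-step` are telescoping identities for an open orbit; at N = d the
    -- boundary values `g n` and `g (n + N * s)` coincide.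
    orbitSum-step : ∀ N n → orbitSum N (n ℕ.+ s) + g n ≡ orbitSum N n + g (n ℕ.+ N ℕ.* s)
    orbitSum-step zero    n = cong (λ t → 0ℚ + g t) (sym (ℕ.+-identityʳ n))
    orbitSum-step (suc N) n = begin
      orbitSum N (n ℕ.+ s) + g (n ℕ.+ s ℕ.+ N ℕ.* s) + g n
        ≡⟨ cong (λ y → orbitSum N (n ℕ.+ s) + y + g n) (next n N) ⟩
      orbitSum N (n ℕ.+ s) + g (n ℕ.+ suc N ℕ.* s) + g n
        ≡⟨ swap (orbitSum N (n ℕ.+ s)) (g (n ℕ.+ suc N ℕ.* s)) (g n) ⟩
      orbitSum N (n ℕ.+ s) + g n + g (n ℕ.+ suc N ℕ.* s)
        ≡⟨ cong (_+ g (n ℕ.+ suc N ℕ.* s)) (orbitSum-step N n) ⟩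
      orbitSum N n + g (n ℕ.+ N ℕ.* s) + g (n ℕ.+ suc N ℕ.* s) ∎
      where
      open +-*-Solver
      swap : ∀ a b c → a + b + c ≡ a + c + b
      swap = solve 3 (λ a b c → a :+ b :+ c := a :+ c :+ b) refl

    weightedSum-step : ∀ N n → weightedSum N (n ℕ.+ s) + orbitSum N n + g (n ℕ.+ N ℕ.* s)
                             ≡ weightedSum N n + ι N * g (n ℕ.+ N ℕ.* s) + g n
    weightedSum-step zero n = begin
      0ℚ + 0ℚ + g (n ℕ.+ 0)                 ≡⟨ cong (λ x → 0ℚ + 0ℚ + g x) (ℕ.+-identityʳ n) ⟩
      0ℚ + 0ℚ + g n                         ≡⟨ cong (λ x → 0ℚ + x + g n) (trans (cong (_* g (n ℕ.+ 0)) ι-0) (ℚ.*-zeroˡ (g (n ℕ.+ 0)))) ⟨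
      0ℚ + ι 0 * g (n ℕ.+ 0) + g n          ∎
    weightedSum-step (suc N) n = begin
      weightedSum N (n ℕ.+ s) + ι N * g (n ℕ.+ s ℕ.+ N ℕ.* s) + (orbitSum N n + y) + x
        ≡⟨ cong (λ t → weightedSum N (n ℕ.+ s) + ι N * t + (orbitSum N n + y) + x) (next n N) ⟩
      weightedSum N (n ℕ.+ s) + ι N * x + (orbitSum N n + y) + x
        ≡⟨ regroup (weightedSum N (n ℕ.+ s)) (ι N) x (orbitSum N n) y ⟩
      weightedSum N (n ℕ.+ s) + orbitSum N n + y + (1ℚ + ι N) * x
        ≡⟨ cong₂ (λ u v → u + v * x) (weightedSum-step N n) (sym (trans (ι-+ 1 N) (cong (_+ ι N) ι-1))) ⟩
      weightedSum N n + ι N * y + g n + ι (suc N) * x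
        ≡⟨ swap (weightedSum N n + ι N * y) (g n) (ι (suc N) * x) ⟩
      weightedSum N n + ι N * y + ι (suc N) * x + g n ∎
      where
      open +-*-Solver
      x = g (n ℕ.+ suc N ℕ.* s)
      y = g (n ℕ.+ N ℕ.* s)
      swap : ∀ a b c → a + b + c ≡ a + c + b
      swap = solve 3 (λ a b c → a :+ b :+ c := a :+ c :+ b) refl
      regroup : ∀ a N x o y → a + N * x + (o + y) + x ≡ a + o + y + (1ℚ + N) * x
      regroup = solve 5 (λ a N x o y → a :+ N :* x :+ (o :+ y) :+ x := a :+ o :+ y :+ (con 1ℚ :+ N) :* x) refl

    module _ {d} (per : Periodic d g) where

      orbitSum-periodic : ∀ N → Periodic d (orbitSum N)
      orbitSum-periodic zero    n = refl
      orbitSum-periodic (suc N) n = cong₂ _+_ (orbitSum-periodic N n) (periodic-translate (N ℕ.* s) per n)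

      weightedSum-periodic : ∀ N → Periodic d (weightedSum N)
      weightedSum-periodic zero    n = refl
      weightedSum-periodic (suc N) n =
        cong₂ (λ u v → u + ι N * v) (weightedSum-periodic N n) (periodic-translate (N ℕ.* s) per n)

  -- A d-periodic g splits as g₀ + Δₛh, where g₀ is its mean along the orbits of n ↦ n + s.
  record OrbitSplitting (d s : ℕ) (g : ℕ → ℚ) : Set where
    field
      g₀ h       : ℕ → ℚ
      g₀-per     : Periodic d g₀
      h-per      : Periodic d h
      g₀-step    : Periodic s g₀
      h-step     : ∀ n → h (n ℕ.+ s) ≡ h n + g n - g₀ n

  -- After d steps of length s the argument is back modulo d. If d and s have a common factor the
  -- orbit is traversed several times, which leaves the mean unchanged. The factor δ is 1/d.
  orbitSplitting : ∀ {d} s {g} → 0 < d → Periodic d g → OrbitSplitting d s g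
  orbitSplitting {d} s {g} 0<d per = record
    { g₀      = λ n → δ * orbitSum d n
    ; h       = λ n → δ * weightedSum d n
    ; g₀-per  = λ n → cong (δ *_) (orbitSum-periodic per d n)
    ; h-per   = λ n → cong (δ *_) (weightedSum-periodic per d n)
    ; g₀-step = λ n → cong (δ *_) (∙-cancelʳ (g n) (orbitSum d (n ℕ.+ s)) (orbitSum d n) (trans (orbitSum-step d n) (cong (λ t → orbitSum d n + t) (return n))))
    ; h-step  = λ n → solveStep δ (ι d) (weightedSum d (n ℕ.+ s)) (orbitSum d n) (weightedSum d n) (g n) δd≡1
        (trans (cong (λ t → weightedSum d (n ℕ.+ s) + orbitSum d n + t) (sym (return n)))
          (trans (weightedSum-step d n) (cong (λ t → weightedSum d n + ι d * t + g n) (return n))))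
    }
    where
    open Averaging s g
    δ : ℚ
    δ = proj₁ (ι-inverse d 0<d)
    δd≡1 : δ * ι d ≡ 1ℚ
    δd≡1 = proj₂ (ι-inverse d 0<d)
    return : ∀ n → g (n ℕ.+ d ℕ.* s) ≡ g n
    return n = trans (cong (λ t → g (n ℕ.+ t)) (ℕ.*-comm d s)) (periodic-multiple per s n)
    solveStep : ∀ δ D W' A W x → δ * D ≡ 1ℚ → W' + A + x ≡ W + D * x + x → δ * W' ≡ δ * W + x - δ * A
    solveStep δ D W' A W x δD≡1 eq = begin
      δ * W'                                    ≡⟨ solve 4 (λ δ W' A x → δ :* W' := δ :* (W' :+ A :+ x) :- δ :* A :- δ :* x) refl δ W' A x ⟩
      δ * (W' + A + x) - δ * A - δ * x          ≡⟨ cong (λ t → δ * t - δ * A - δ * x) eq ⟩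
      δ * (W + D * x + x) - δ * A - δ * x       ≡⟨ solve 5 (λ δ D A W x → δ :* (W :+ D :* x :+ x) :- δ :* A :- δ :* x := δ :* W :+ δ :* D :* x :- δ :* A) refl δ D A W x ⟩
      δ * W + δ * D * x - δ * A                 ≡⟨ cong (λ t → δ * W + t * x - δ * A) δD≡1 ⟩
      δ * W + 1ℚ * x - δ * A                    ≡⟨ cong (λ t → δ * W + t - δ * A) (ℚ.*-identityˡ x) ⟩
      δ * W + x - δ * A                         ∎
      where open +-*-Solver

  pow : ℕ → ℕ → ℚ
  pow i n = ι (n ^ i)

  pow-suc : ∀ i n → pow (suc i) n ≡ ι n * pow i n
  pow-suc i n = ι-* n (n ^ i)

  -- Quasipolynomials of degree < i all of whose coefficients have period d.
  QuasiPoly : ℕ → ℕ → (ℕ → ℚ) → Set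
  QuasiPoly d zero    F = ∀ n → F n ≡ 0ℚ
  QuasiPoly d (suc i) F = Σ (ℕ → ℚ) λ g → Σ (ℕ → ℚ) λ F' →
    Periodic d g × QuasiPoly d i F' × (∀ n → F n ≡ g n * pow i n + F' n)

  module _ {d : ℕ} where

    qp-+ : ∀ i {F F'} → QuasiPoly d i F → QuasiPoly d i F' → QuasiPoly d i (λ n → F n + F' n)
    qp-+ zero    z z' n = cong₂ _+_ (z n) (z' n)
    qp-+ (suc i) (g , G , per , q , e) (g' , G' , per' , q' , e') =
      (λ n → g n + g' n) , (λ n → G n + G' n) , (λ n → cong₂ _+_ (per n) (per' n)) , qp-+ i q q'
      , λ n → trans (cong₂ _+_ (e n) (e' n)) (regroup (g n) (g' n) (pow i n) (G n) (G' n))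
      where
      open +-*-Solver
      regroup : ∀ g g' p G G' → g * p + G + (g' * p + G') ≡ (g + g') * p + (G + G')
      regroup = solve 5 (λ g g' p G G' → g :* p :+ G :+ (g' :* p :+ G') := (g :+ g') :* p :+ (G :+ G')) refl

    qp-* : ∀ i {h F} → Periodic d h → QuasiPoly d i F → QuasiPoly d i (λ n → h n * F n)
    qp-* zero    {h} hper z n = trans (cong (h n *_) (z n)) (ℚ.*-zeroʳ (h n))
    qp-* (suc i) {h} hper (g , G , per , q , e) =
      (λ n → h n * g n) , (λ n → h n * G n) , (λ n → cong₂ _*_ (hper n) (per n)) , qp-* i hper q
      , λ n → trans (cong (h n *_) (e n)) (regroup (h n) (g n) (pow i n) (G n))
      where
      open +-*-Solver
      regroup : ∀ h g p G → h * (g * p + G) ≡ h * g * p + h * G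
      regroup = solve 4 (λ h g p G → h :* (g :* p :+ G) := h :* g :* p :+ h :* G) refl

    qp-weaken : ∀ i {F} → QuasiPoly d i F → QuasiPoly d (suc i) F
    qp-weaken i {F} q = (λ _ → 0ℚ) , F , (λ _ → refl) , q
      , λ n → sym (trans (cong (_+ F n) (ℚ.*-zeroˡ (pow i n))) (ℚ.+-identityˡ (F n)))

    qp-monomial : ∀ i {g} → Periodic d g → QuasiPoly d (suc i) (λ n → g n * pow i n)
    qp-monomial i {g} per = g , (λ _ → 0ℚ) , per , qp-0 i , λ n → sym (ℚ.+-identityʳ (g n * pow i n))
      where
      qp-0 : ∀ i → QuasiPoly d i (λ _ → 0ℚ)
      qp-0 zero    n = refl
      qp-0 (suc i) = qp-weaken i (qp-0 i)

    qp-n* : ∀ i {F} → QuasiPoly d i F → QuasiPoly d (suc i) (λ n → ι n * F n)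
    qp-n* zero    {F} z = qp-weaken zero (λ n → trans (cong (ι n *_) (z n)) (ℚ.*-zeroʳ (ι n)))
    qp-n* (suc i) {F} (g , G , per , q , e) = g , (λ n → ι n * G n) , per , qp-n* i q
      , λ n → begin
        ι n * F n                              ≡⟨ cong (ι n *_) (e n) ⟩
        ι n * (g n * pow i n + G n)            ≡⟨ regroup (ι n) (g n) (pow i n) (G n) ⟩
        g n * (ι n * pow i n) + ι n * G n   ≡⟨ cong (λ t → g n * t + ι n * G n) (pow-suc i n) ⟨
        g n * pow (suc i) n + ι n * G n        ∎
      where
      open +-*-Solver
      regroup : ∀ x g p G → x * (g * p + G) ≡ g * (x * p) + x * G
      regroup = solve 4 (λ x g p G → x :* (g :* p :+ G) := g :* (x :* p) :+ x :* G) refl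

    -- The binomial expansion of (n + s)^(i+1), with its second coefficient (i + 1)s kept explicit
    -- because the antidifference divides by it.
    qp-powRemainder : ∀ s i → Σ (ℕ → ℚ) λ E → QuasiPoly d i E ×
      (∀ n → pow (suc i) (n ℕ.+ s) ≡ pow (suc i) n + ι (suc i ℕ.* s) * pow i n + E n)
    qp-powRemainder s zero = (λ _ → 0ℚ) , (λ _ → refl) , λ n → begin
      pow 1 (n ℕ.+ s)                       ≡⟨ cong ι (solve 2 (λ n s → (n :+ s) :* con 1 := n :* con 1 :+ (con 1 :* s) :* con 1) refl n s) ⟩
      ι (n ^ 1 ℕ.+ (1 ℕ.* s) ℕ.* n ^ 0)  ≡⟨ ι-+ (n ^ 1) ((1 ℕ.* s) ℕ.* n ^ 0) ⟩
      pow 1 n + ι ((1 ℕ.* s) ℕ.* 1)      ≡⟨ cong (λ t → pow 1 n + t) (ι-* (1 ℕ.* s) 1) ⟩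
      pow 1 n + ι (1 ℕ.* s) * pow 0 n    ≡⟨ ℚ.+-identityʳ (pow 1 n + ι (1 ℕ.* s) * pow 0 n) ⟨
      pow 1 n + ι (1 ℕ.* s) * pow 0 n + 0ℚ ∎
      where open ℕ.+-*-Solver
    qp-powRemainder s (suc i) with qp-powRemainder s i
    ... | E , qE , eq = (λ n → ι n * E n + (σ * E n + c * pow i n))
      , (qp-+ (suc i) (qp-n* i qE)
          (qp-+ (suc i) (qp-weaken i (qp-* i {h = λ _ → σ} (λ _ → refl) qE)) (qp-monomial i {g = λ _ → c} (λ _ → refl))))
      , λ n → begin
        pow (suc (suc i)) (n ℕ.+ s)
          ≡⟨ pow-suc (suc i) (n ℕ.+ s) ⟩
        ι (n ℕ.+ s) * pow (suc i) (n ℕ.+ s)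
          ≡⟨ cong₂ _*_ (ι-+ n s) (eq n) ⟩
        (ι n + σ) * (pow (suc i) n + r * pow i n + E n)
          ≡⟨ expand₁ (ι n) σ (pow (suc i) n) r (pow i n) (E n) ⟩
        ι n * pow (suc i) n + σ * pow (suc i) n + r * (ι n * pow i n) + (ι n * E n + (σ * E n + σ * r * pow i n))
          ≡⟨ cong₂ (λ t u → t + σ * pow (suc i) n + r * u + (ι n * E n + (σ * E n + σ * r * pow i n)))
                   (sym (pow-suc (suc i) n)) (sym (pow-suc i n)) ⟩
        pow (suc (suc i)) n + σ * pow (suc i) n + r * pow (suc i) n + (ι n * E n + (σ * E n + σ * r * pow i n))
          ≡⟨ cong (_+ (ι n * E n + (σ * E n + σ * r * pow i n))) (collect (pow (suc (suc i)) n) σ (pow (suc i) n) r) ⟩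
        pow (suc (suc i)) n + (σ + r) * pow (suc i) n + (ι n * E n + (σ * E n + σ * r * pow i n))
          ≡⟨ cong (λ t → pow (suc (suc i)) n + t * pow (suc i) n + (ι n * E n + (σ * E n + σ * r * pow i n)))
                  (ι-+ s (suc i ℕ.* s)) ⟨
        pow (suc (suc i)) n + ι (suc (suc i) ℕ.* s) * pow (suc i) n + (ι n * E n + (σ * E n + c * pow i n)) ∎
      where
      open +-*-Solver
      σ r c : ℚ
      σ = ι s
      r = ι (suc i ℕ.* s)
      c = σ * r
      expand₁ : ∀ x σ P r p E → (x + σ) * (P + r * p + E) ≡ x * P + σ * P + r * (x * p) + (x * E + (σ * E + σ * r * p))
      expand₁ = solve 6 (λ x σ P r p E → (x :+ σ) :* (P :+ r :* p :+ E) := x :* P :+ σ :* P :+ r :* (x :* p) :+ (x :* E :+ (σ :* E :+ σ :* r :* p))) refl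
      collect : ∀ Q σ P r → Q + σ * P + r * P ≡ Q + (σ + r) * P
      collect = solve 4 (λ Q σ P r → Q :+ σ :* P :+ r :* P := Q :+ (σ :+ r) :* P) refl

    qp-powDifference : ∀ s i → Σ (ℕ → ℚ) λ D → QuasiPoly d i D × (∀ n → pow i (n ℕ.+ s) ≡ pow i n + D n)
    qp-powDifference s zero = (λ _ → 0ℚ) , (λ _ → refl) , λ n → sym (ℚ.+-identityʳ (ι 1))
    qp-powDifference s (suc i) with qp-powRemainder s i
    ... | E , qE , eq = (λ n → ι (suc i ℕ.* s) * pow i n + E n)
      , qp-+ (suc i) (qp-monomial i {g = λ _ → ι (suc i ℕ.* s)} (λ _ → refl)) (qp-weaken i qE)
      , λ n → trans (eq n) (ℚ.+-assoc (pow (suc i) n) (ι (suc i ℕ.* s) * pow i n) (E n))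

    -- Write g = g₀ + Δₛh for the leading coefficient and κ = 1/((i + 1)s). Since g₀ is s-periodic
    -- it acts as a constant, and κ g₀ n^(i+1) + h n^i has s-difference g n^i plus the errors κ g₀ E
    -- and h(n + s) D, both of degree below i. With reversed sign they join the lower part F' in
    -- `R`, which the recursion treats.
    qp-antidifference : ∀ {s} → 0 < s → 0 < d → ∀ i {F} → QuasiPoly d i F →
      Σ (ℕ → ℚ) λ u → QuasiPoly d (suc i) u × (∀ n → u (n ℕ.+ s) ≡ u n + F n)
    qp-antidifference 0<s 0<d zero {F} z = (λ _ → 0ℚ) , qp-weaken 0 (λ _ → refl)
      , λ n → sym (cong (λ t → 0ℚ + t) (z n))
    qp-antidifference {s} 0<s 0<d (suc i) {F} (g , F' , per , q , e)
      with orbitSplitting s 0<d per | qp-powRemainder s i | qp-powDifference s i | ι-inverse (suc i ℕ.* s) (ℕ.<-≤-trans 0<s (ℕ.m≤m+n s (i ℕ.* s)))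
    ... | split | E , qE , E-eq | D , qD , D-eq | κ , κc≡1 = u , qu , u-step
      where
      open OrbitSplitting split
      R : ℕ → ℚ
      R n = F' n + ((- 1ℚ * h (n ℕ.+ s)) * D n + (- κ * g₀ n) * E n)
      qR : QuasiPoly d i R
      qR = qp-+ i q (qp-+ i (qp-* i (λ n → cong (- 1ℚ *_) (periodic-translate s h-per n)) qD)
                            (qp-* i (λ n → cong (- κ *_) (g₀-per n)) qE))
      rest : Σ (ℕ → ℚ) λ v → QuasiPoly d (suc i) v × (∀ n → v (n ℕ.+ s) ≡ v n + R n)
      rest = qp-antidifference 0<s 0<d i qR
      v : ℕ → ℚ
      v = proj₁ rest
      u : ℕ → ℚ
      u n = (κ * g₀ n) * pow (suc i) n + (h n * pow i n + v n)
      qu : QuasiPoly d (suc (suc i)) u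
      qu = (λ n → κ * g₀ n) , (λ n → h n * pow i n + v n) , (λ n → cong (κ *_) (g₀-per n))
         , qp-+ (suc i) (qp-monomial i h-per) (proj₁ (proj₂ rest)) , λ _ → refl
      open +-*-Solver
      algebra : ∀ κ c g₀ g h P p E D F' v →
        (κ * g₀) * (P + c * p + E) + ((h + g - g₀) * (p + D) + (v + (F' + ((- 1ℚ * (h + g - g₀)) * D + (- κ * g₀) * E))))
        ≡ (κ * g₀) * P + (h * p + v) + ((κ * c * g₀ + (g - g₀)) * p + F')
      algebra = solve 11 (λ κ c g₀ g h P p E D F' v →
        (κ :* g₀) :* (P :+ c :* p :+ E) :+ ((h :+ g :- g₀) :* (p :+ D) :+ (v :+ (F' :+ ((:- con 1ℚ :* (h :+ g :- g₀)) :* D :+ (:- κ :* g₀) :* E))))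
        := (κ :* g₀) :* P :+ (h :* p :+ v) :+ ((κ :* c :* g₀ :+ (g :- g₀)) :* p :+ F')) refl
      cancel : ∀ g₀ g → 1ℚ * g₀ + (g - g₀) ≡ g
      cancel = solve 2 (λ g₀ g → con 1ℚ :* g₀ :+ (g :- g₀) := g) refl
      u-step : ∀ n → u (n ℕ.+ s) ≡ u n + F n
      u-step n = begin
        (κ * g₀ (n ℕ.+ s)) * pow (suc i) (n ℕ.+ s) + (h (n ℕ.+ s) * pow i (n ℕ.+ s) + v (n ℕ.+ s))
          ≡⟨ cong₂ _+_ (cong₂ (λ a b → (κ * a) * b) (g₀-step n) (E-eq n))
                       (cong₂ _+_ (cong₂ _*_ (h-step n) (D-eq n))
                         (trans (proj₂ (proj₂ rest) n)
                           (cong (λ a → v n + (F' n + ((- 1ℚ * a) * D n + (- κ * g₀ n) * E n))) (h-step n)))) ⟩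
        _ ≡⟨ algebra κ (ι (suc i ℕ.* s)) (g₀ n) (g n) (h n) (pow (suc i) n) (pow i n) (E n) (D n) (F' n) (v n) ⟩
        u n + ((κ * ι (suc i ℕ.* s) * g₀ n + (g n - g₀ n)) * pow i n + F' n)
          ≡⟨ cong (λ a → u n + ((a * g₀ n + (g n - g₀ n)) * pow i n + F' n)) κc≡1 ⟩
        u n + ((1ℚ * g₀ n + (g n - g₀ n)) * pow i n + F' n)
          ≡⟨ cong (λ a → u n + (a * pow i n + F' n)) (cancel (g₀ n) (g n)) ⟩
        u n + (g n * pow i n + F' n)
          ≡⟨ cong (λ t → u n + t) (e n) ⟨
        u n + F n ∎

  -- Each term keeps its own period: merging terms of different periods would lead to common
  -- multiples, which may divide no element of `T`.
  record Term (T : List ℕ) : Set where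
    field
      degree period : ℕ
      period>0      : 0 < period
      period∣       : Any (period ∣_) T
      coefficient   : ℕ → ℚ
      periodic      : Periodic period coefficient

  open Term

  evalTerm : ∀ {T} → Term T → ℕ → ℚ
  evalTerm t n = coefficient t n * pow (degree t) n

  ⟪_⟫ : ∀ {T} → List (Term T) → ℕ → ℚ
  ⟪ []     ⟫ n = 0ℚ
  ⟪ t ∷ ts ⟫ n = evalTerm t n + ⟪ ts ⟫ n

  ⟪⟫-++ : ∀ {T} (ts us : List (Term T)) n → ⟪ ts ++ us ⟫ n ≡ ⟪ ts ⟫ n + ⟪ us ⟫ n
  ⟪⟫-++ []       us n = sym (ℚ.+-identityˡ (⟪ us ⟫ n))
  ⟪⟫-++ (t ∷ ts) us n = trans (cong (λ x → evalTerm t n + x) (⟪⟫-++ ts us n))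
                              (sym (ℚ.+-assoc (evalTerm t n) (⟪ ts ⟫ n) (⟪ us ⟫ n)))

  qp⇒terms : ∀ {T d} → 0 < d → Any (d ∣_) T → ∀ i {F} → QuasiPoly d i F → Σ (List (Term T)) λ ts → F ≗ ⟪ ts ⟫
  qp⇒terms 0<d d∣ zero    z = [] , z
  qp⇒terms {d = d} 0<d d∣ (suc i) (g , F' , per , q , e) with qp⇒terms 0<d d∣ i q
  ... | ts , eq = record { degree = i ; period = d ; period>0 = 0<d ; period∣ = d∣ ; coefficient = g ; periodic = per } ∷ ts
    , λ n → trans (e n) (cong (λ x → g n * pow i n + x) (eq n))

  Antidifference : ∀ {T} → ℕ → (ℕ → ℚ) → Set
  Antidifference {T} s F = Σ (List (Term T)) λ us → ∀ n → ⟪ us ⟫ (n ℕ.+ s) ≡ ⟪ us ⟫ n + F n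

  term-antidifference : ∀ {T s} → 0 < s → (t : Term T) → Antidifference {T} s (evalTerm t)
  term-antidifference {T} {s} 0<s t = fromQuasiPoly
    (qp-antidifference 0<s (period>0 t) (suc (degree t)) (qp-monomial (degree t) {coefficient t} (periodic t)))
    where
    fromQuasiPoly : (Σ (ℕ → ℚ) λ u → QuasiPoly (period t) (suc (suc (degree t))) u × (∀ n → u (n ℕ.+ s) ≡ u n + evalTerm t n)) →
                    Antidifference {T} s (evalTerm t)
    fromQuasiPoly (u , qu , step) = fromTerms (qp⇒terms (period>0 t) (period∣ t) (suc (suc (degree t))) {u} qu)
      where
      fromTerms : (Σ (List (Term T)) λ us → u ≗ ⟪ us ⟫) → Antidifference {T} s (evalTerm t)
      fromTerms (us , eq) = us , λ n → trans (sym (eq (n ℕ.+ s))) (trans (step n) (cong (_+ evalTerm t n) (eq n)))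

  antidifference-+ : ∀ {T s F G} → Antidifference {T} s F → Antidifference {T} s G → Antidifference {T} s (λ n → F n + G n)
  antidifference-+ {s = s} {F} {G} (us , us-step) (vs , vs-step) = us ++ vs , λ n → begin
    ⟪ us ++ vs ⟫ (n ℕ.+ s)                   ≡⟨ ⟪⟫-++ us vs (n ℕ.+ s) ⟩
    ⟪ us ⟫ (n ℕ.+ s) + ⟪ vs ⟫ (n ℕ.+ s)      ≡⟨ cong₂ _+_ (us-step n) (vs-step n) ⟩
    ⟪ us ⟫ n + F n + (⟪ vs ⟫ n + G n)        ≡⟨ interchange (⟪ us ⟫ n) (F n) (⟪ vs ⟫ n) (G n) ⟩
    ⟪ us ⟫ n + ⟪ vs ⟫ n + (F n + G n)        ≡⟨ cong (_+ (F n + G n)) (⟪⟫-++ us vs n) ⟨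
    ⟪ us ++ vs ⟫ n + (F n + G n)             ∎
    where
    open +-*-Solver
    interchange : ∀ a b c d → a + b + (c + d) ≡ a + c + (b + d)
    interchange = solve 4 (λ a b c d → a :+ b :+ (c :+ d) := a :+ c :+ (b :+ d)) refl

  terms-antidifference : ∀ {T s} → 0 < s → (ts : List (Term T)) → Antidifference {T} s ⟪ ts ⟫
  terms-antidifference 0<s []       = [] , λ _ → refl
  terms-antidifference 0<s (t ∷ ts) = antidifference-+ (term-antidifference 0<s t) (terms-antidifference 0<s ts)

  EventuallyTerms : List ℕ → (ℕ → ℤ) → Set
  EventuallyTerms T a = Σ (List (Term T)) λ ts → Σ ℕ λ N → ∀ n → N ≤ n → ℤtoℚ (a n) ≡ ⟪ ts ⟫ n

  eventuallyTerms-mulOneMinusQ^⁻ : ∀ {T s} → 0 < s → Any (s ∣_) T → ∀ {a} →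
    EventuallyTerms T (mulOneMinusQ^ s a) → EventuallyTerms T a
  eventuallyTerms-mulOneMinusQ^⁻ {T} {s} 0<s s∣ {a} (ts , N , eq) with terms-antidifference 0<s ts
  ... | vs , vs-step = residual ∷ us , N , λ n N≤n → begin
    ℤtoℚ (a n)                          ≡⟨ split (ℤtoℚ (a n)) (⟪ us ⟫ n) ⟩
    ρ n + ⟪ us ⟫ n                      ≡⟨ cong (_+ ⟪ us ⟫ n) (ρ-multiple N n N≤n) ⟨
    ρ (n ℕ.+ N ℕ.* s) + ⟪ us ⟫ n        ≡⟨ cong (_+ ⟪ us ⟫ n) (trans (cong (ρ (n ℕ.+ N ℕ.* s) *_) ι-1) (ℚ.*-identityʳ (ρ (n ℕ.+ N ℕ.* s)))) ⟨
    ρ (n ℕ.+ N ℕ.* s) * pow 0 n + ⟪ us ⟫ n ∎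
    where
    open +-*-Solver
    us : List (Term T)
    -- The s-difference of `vs` is ts(n), whereas a(n + s) - a(n) is ts(n + s). Adding `ts`, whose
    -- own difference is ts(n + s) - ts(n), bridges the two.
    us = vs ++ ts
    us-step : ∀ n → ⟪ us ⟫ (n ℕ.+ s) ≡ ⟪ us ⟫ n + ⟪ ts ⟫ (n ℕ.+ s)
    us-step n = trans (⟪⟫-++ vs ts (n ℕ.+ s))
      (cong (_+ ⟪ ts ⟫ (n ℕ.+ s)) (trans (vs-step n) (sym (⟪⟫-++ vs ts n))))
    a-step : ∀ n → N ≤ n → ℤtoℚ (a (n ℕ.+ s)) ≡ ℤtoℚ (a n) + ⟪ ts ⟫ (n ℕ.+ s)
    a-step n N≤n = begin
      ℤtoℚ (a (n ℕ.+ s))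
        ≡⟨ cong ℤtoℚ (ℤsplit (a (n ℕ.+ s)) (a n)) ⟩
      ℤtoℚ (a n ℤ.+ (a (n ℕ.+ s) ℤ.- a n))
        ≡⟨ ℤtoℚ-+ (a n) _ ⟩
      ℤtoℚ (a n) + ℤtoℚ (a (n ℕ.+ s) ℤ.- a n)
        ≡⟨ cong (λ x → ℤtoℚ (a n) + ℤtoℚ (a (n ℕ.+ s) ℤ.- x)) (trans (shift-≤ a (ℕ.m≤n+m s n)) (cong a (ℕ.m+n∸n≡m n s))) ⟨
      ℤtoℚ (a n) + ℤtoℚ (a (n ℕ.+ s) ℤ.- qShift s a (n ℕ.+ s))
        ≡⟨ cong (λ x → ℤtoℚ (a n) + ℤtoℚ x) (mulOneMinusQ^-≗ s a (n ℕ.+ s)) ⟨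
      ℤtoℚ (a n) + ℤtoℚ (mulOneMinusQ^ s a (n ℕ.+ s))
        ≡⟨ cong (λ x → ℤtoℚ (a n) + x) (eq (n ℕ.+ s) (ℕ.≤-trans N≤n (ℕ.m≤m+n n s))) ⟩
      ℤtoℚ (a n) + ⟪ ts ⟫ (n ℕ.+ s) ∎
      where
      ℤsplit : ∀ x y → x ≡ y ℤ.+ (x ℤ.- y)
      ℤsplit = ℤ.+-*-Solver.solve 2 (λ x y → x ℤS.:= y ℤS.:+ (x ℤS.:- y)) refl
        where module ℤS = ℤ.+-*-Solver
    ρ : ℕ → ℚ
    ρ n = ℤtoℚ (a n) - ⟪ us ⟫ n
    ρ-step : ∀ n → N ≤ n → ρ (n ℕ.+ s) ≡ ρ n
    ρ-step n N≤n = trans (cong₂ _-_ (a-step n N≤n) (us-step n)) (cancel (ℤtoℚ (a n)) (⟪ us ⟫ n) (⟪ ts ⟫ (n ℕ.+ s)))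
      where
      cancel : ∀ x y z → (x + z) - (y + z) ≡ x - y
      cancel = solve 3 (λ x y z → (x :+ z) :- (y :+ z) := x :- y) refl
    split : ∀ x y → x ≡ x - y + y
    split = solve 2 (λ x y → x := x :- y :+ y) refl
    ρ-multiple : ∀ k n → N ≤ n → ρ (n ℕ.+ k ℕ.* s) ≡ ρ n
    ρ-multiple zero    n N≤n = cong ρ (ℕ.+-identityʳ n)
    ρ-multiple (suc k) n N≤n = begin
      ρ (n ℕ.+ (s ℕ.+ k ℕ.* s))   ≡⟨ cong ρ (ℕ.+-assoc n s (k ℕ.* s)) ⟨
      ρ (n ℕ.+ s ℕ.+ k ℕ.* s)     ≡⟨ ρ-multiple k (n ℕ.+ s) (ℕ.≤-trans N≤n (ℕ.m≤m+n n s)) ⟩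
      ρ (n ℕ.+ s)                 ≡⟨ ρ-step n N≤n ⟩
      ρ n                         ∎
    -- ρ is s-periodic only from N on; since N ≤ N * s, translating by N * s makes it so everywhere.
    residual : Term T
    residual = record
      { degree = 0 ; period = s ; period>0 = 0<s ; period∣ = s∣
      ; coefficient = λ n → ρ (n ℕ.+ N ℕ.* s)
      ; periodic = λ n → trans (cong ρ (reorder n)) (ρ-step (n ℕ.+ N ℕ.* s) (N≤ n)) }
      where
      reorder : ∀ n → n ℕ.+ s ℕ.+ N ℕ.* s ≡ n ℕ.+ N ℕ.* s ℕ.+ s
      reorder n = ℕS.solve 3 (λ n s t → n ℕS.:+ s ℕS.:+ t ℕS.:= n ℕS.:+ t ℕS.:+ s) refl n s (N ℕ.* s)
        where module ℕS = ℕ.+-*-Solver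
      N≤ : ∀ n → N ≤ n ℕ.+ N ℕ.* s
      N≤ n = ℕ.≤-trans (ℕ.m≤m*n N s {{ℕ.>-nonZero 0<s}}) (ℕ.m≤n+m (N ℕ.* s) n)

  -- `T` stays the full list while `S` is stripped, so the periods already collected remain divisors
  -- of its elements.
  eventuallyTerms-mulProd⁻ : ∀ {T} S → All (0 <_) S → All (λ s → Any (s ∣_) T) S → ∀ {a} →
    EventuallyTerms T (mulProd S a) → EventuallyTerms T a
  eventuallyTerms-mulProd⁻ []      []          []         e = e
  eventuallyTerms-mulProd⁻ (s ∷ S) (0<s ∷ pos) (s∣ ∷ S∣) e =
    eventuallyTerms-mulProd⁻ S pos S∣ (eventuallyTerms-mulOneMinusQ^⁻ 0<s s∣ e)

  -- Collecting terms by degree into the coefficients c_i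

  select : ℕ → ℕ → ℚ → ℚ
  select zero    zero    x = x
  select zero    (suc i) x = 0ℚ
  select (suc e) zero    x = 0ℚ
  select (suc e) (suc i) x = select e i x

  sumℚ-0 : ∀ N (f : Fin N → ℚ) → sumℚ N (λ i → 0ℚ * f i) ≡ 0ℚ
  sumℚ-0 zero    f = refl
  sumℚ-0 (suc N) f = cong₂ _+_ (ℚ.*-zeroˡ (f zero)) (sumℚ-0 N (λ i → f (suc i)))

  sumℚ-distrib : ∀ N (a b f : Fin N → ℚ) →
    sumℚ N (λ i → (a i + b i) * f i) ≡ sumℚ N (λ i → a i * f i) + sumℚ N (λ i → b i * f i)
  sumℚ-distrib zero    a b f = refl
  sumℚ-distrib (suc N) a b f = trans (cong (λ t → (a zero + b zero) * f zero + t) (sumℚ-distrib N (λ i → a (suc i)) (λ i → b (suc i)) (λ i → f (suc i))))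
    (regroup (a zero) (b zero) (f zero) (sumℚ N (λ i → a (suc i) * f (suc i))) (sumℚ N (λ i → b (suc i) * f (suc i))))
    where
    open +-*-Solver
    regroup : ∀ a b f x y → (a + b) * f + (x + y) ≡ a * f + x + (b * f + y)
    regroup = solve 5 (λ a b f x y → (a :+ b) :* f :+ (x :+ y) := a :* f :+ x :+ (b :* f :+ y)) refl

  sumℚ-select : ∀ N e x (f : ℕ → ℚ) → e < N → sumℚ N (λ i → select e (toℕ i) x * f (toℕ i)) ≡ x * f e
  sumℚ-select (suc N) zero    x f _         =
    trans (cong (λ t → x * f 0 + t) (sumℚ-0 N (λ i → f (suc (toℕ i))))) (ℚ.+-identityʳ (x * f 0))
  sumℚ-select (suc N) (suc e) x f (s≤s e<N) =
    trans (cong₂ _+_ (ℚ.*-zeroˡ (f 0)) (sumℚ-select N e x (λ i → f (suc i)) e<N)) (ℚ.+-identityˡ (x * f (suc e)))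

  termPart : ∀ {T} → Term T → ℕ → ℕ → ℚ
  termPart t i n = select (degree t) i (coefficient t n)

  -- `select` is a Kronecker delta, so every c_i is a sum over all terms: those of another degree
  -- contribute the zero function, which still has their period.
  coefficientAt : ∀ {T} → List (Term T) → ℕ → ℕ → ℚ
  coefficientAt ts i n = sumℚ (length ts) (λ j → termPart (lookup ts j) i n)

  sumℚ-coefficientAt : ∀ {T} m (ts : List (Term T)) → All (λ t → degree t < m) ts → ∀ n →
    ⟪ ts ⟫ n ≡ sumℚ m (λ i → coefficientAt ts (toℕ i) n * pow (toℕ i) n)
  sumℚ-coefficientAt m []       []       n = sym (sumℚ-0 m (λ i → pow (toℕ i) n))
  sumℚ-coefficientAt m (t ∷ ts) (lt ∷ lts) n = sym (trans
    (sumℚ-distrib m (λ i → termPart t (toℕ i) n) (λ i → coefficientAt ts (toℕ i) n) (λ i → pow (toℕ i) n))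
    (cong₂ _+_ (sumℚ-select m (degree t) (coefficient t n) (λ i → pow i n) lt) (sym (sumℚ-coefficientAt m ts lts n))))

  degree-bound : ∀ {T} (ts : List (Term T)) → Σ ℕ λ m → All (λ t → degree t < suc m) ts
  degree-bound []       = 0 , []
  degree-bound (t ∷ ts) with degree-bound ts
  ... | m , bd = degree t ℕ.+ m , s≤s (ℕ.m≤m+n (degree t) m)
               ∷ All.map (λ lt → ℕ.≤-trans lt (s≤s (ℕ.m≤n+m m (degree t)))) bd

  sumℚ-cong : ∀ N {f g : Fin N → ℚ} → f ≗ g → sumℚ N f ≡ sumℚ N g
  sumℚ-cong zero    eq = refl
  sumℚ-cong (suc N) eq = cong₂ _+_ (eq zero) (sumℚ-cong N (λ i → eq (suc i)))

open Quasipolynomials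

-- Both statements from the vanishing of the coefficients of the numerator

open import Data.Nat using (ℕ; suc; _+_; _^_; _≤_; _<_)
open import Data.Nat.Divisibility using (_∣_; ∣-refl)
open import Data.Integer using (ℤ; +_)
open import Data.Rational as ℚ using (ℚ)
open import Data.Fin using (Fin; toℕ)
open import Data.Vec.Properties using (toList∘fromList)
open import Data.Vec.Relation.Unary.All.Properties using (toList⁻)

mulProd-M-eventuallyZero : ∀ S → All (0 <_) S → EventuallyZero (mulProd S (λ n → + M S n))
mulProd-M-eventuallyZero S pos = subst (λ S → EventuallyZero (mulProd S (λ n → + M S n))) (toList∘fromList S)
  (eventuallyZero-≗ (mulProd-cong (toList w) (λ n → cong +_ (M≡count w>0 n))) (mulProd-count-eventuallyZero w>0 _))
  where
  w = fromList S
  w>0 : Positive w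
  w>0 = toList⁻ (subst (All (0 <_)) (sym (toList∘fromList S)) pos)

theorem5 : (S : List ℕ) → Unique S → All (λ s → 0 < s) S →
  -- (1) ∏_{j∈S}(1 - q^j) · 𝓜_S(q) = f_S(q) for a polynomial f_S ∈ ℤ[q]
  (Σ (List ℤ) λ f → ∀ n → conv (prodOneMinusQ S) (λ k → + (M S k)) n ≡ coeff f n)
  ×
  -- (2) eventually M_S is a quasipolynomial Σ_{i ≤ m} c_i(n) n^i, each c_i a
  --     sum of periodic functions with periods dividing elements of S
  (Σ ℕ λ n₀ → Σ ℕ λ m → Σ (Fin (suc m) → ℕ → ℚ) λ c →
    (∀ n → n₀ ≤ n → ℕtoℚ (M S n) ≡ sumℚ (suc m) (λ i → c i n ℚ.* ℕtoℚ (n ^ toℕ i)))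
    × (∀ i → Σ ℕ λ k → Σ (Fin k → ℕ) λ d → Σ (Fin k → ℕ → ℚ) λ g →
        (∀ j → (0 < d j) × Any (λ s → d j ∣ s) S × (∀ n → g j (n + d j) ≡ g j n))
        × (∀ n → c i n ≡ sumℚ k (λ j → g j n))))
theorem5 S _ pos with mulProd-M-eventuallyZero S pos
... | N , vanishes
  -- The numerator vanishes from N on, so the empty list of terms describes it; `T` is S itself,
  -- each s dividing itself.
  with eventuallyTerms-mulProd⁻ S pos (All.tabulate (λ s∈S → lose s∈S ∣-refl)) ([] , N , λ n N≤n → cong ℤtoℚ (vanishes n N≤n))
... | ts , n₀ , eq with degree-bound ts
... | m , bound =
  (applyUpTo (mulProd S M-S) N
    , λ n → trans (conv-prodOneMinusQ S M-S n) (coeff-applyUpTo N (mulProd S M-S) vanishes n))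
  , (n₀ , m , (λ i → coefficientAt ts (toℕ i))
    , (λ n n₀≤n → trans (eq n n₀≤n) (trans (sumℚ-coefficientAt (suc m) ts bound n)
        (sumℚ-cong (suc m) (λ i → cong (coefficientAt ts (toℕ i) n ℚ.*_) (ι≡ℕtoℚ (n ^ toℕ i))))))
    , λ i → length ts , (λ j → Term.period (lookup ts j)) , (λ j → termPart (lookup ts j) (toℕ i))
      , (λ j → Term.period>0 (lookup ts j) , Term.period∣ (lookup ts j)
             , λ n → cong (select (Term.degree (lookup ts j)) (toℕ i)) (Term.periodic (lookup ts j) n))
      , λ n → refl)
  where
  M-S : ℕ → ℤ
  M-S n = + M S n
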